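{- Let $n\ge1$, let $\rho=\Phi_{\mathrm{YZL}}^{ -1}\circ\xi\circ\Phi_{\mathrm{YZL}}:\mathfrak S_n\to\mathfrak S_n$ and let $\pi\in\mathfrak S_n$. Then, componentwise as equalities of (multi)sets, $$(\mathrm{Vnepb},\ \mathrm{Vnepa},\ \mathrm{Vepb},\ \mathrm{Vepa},\ \mathrm{Vnest}\sqcup\mathrm{Vnepb}\setminus\mathrm{Vepa},\ \mathrm{Vnest},\ \mathrm{Vedif}\setminus\mathrm{Vnepb}\setminus\mathrm{Vnepa}\setminus\mathrm{Vnest})(\pi)$$ $$=\kappa_{n+1}\circ(\mathrm{Vepa},\ \mathrm{Vepb},\ \mathrm{Vnepa},\ \mathrm{Vnepb},\ \mathrm{Vnest},\ \mathrm{Vnest}\sqcup\mathrm{Vnepb}\setminus\mathrm{Vepa},\ \mathrm{Vedif}\setminus\mathrm{Vnepb}\setminus\mathrm{Vnepa}\setminus\mathrm{Vnest})(\rho(\pi)),$$ and $$[n-1]\setminus\mathrm{Vnex}(\pi)=\kappa_n(\mathrm{Vnex}(\rho(\pi))).$$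
   Context: $[n]=\{1,\dots,n\}$; $\mathfrak S_n$ is the set of permutations of $[n]$. For multisets, $\sqcup$ adds multiplicities and $\setminus$ subtracts multiplicities, evaluated left to right. $\kappa_N(S)$ is the multiset obtained from $S$ by replacing each element $s$ (with multiplicity) by $N-s$; it is applied componentwise to tuples. Histories. A 2-Motzkin path of length $n$ is a word $w=w_1\cdots w_n$ over $\{\mathrm N,\mathrm S,\mathrm E,\mathrm{dE}\}$ such that, with $h_i:=\#\{j<i: w_j=\mathrm N\}-\#\{j<i: w_j=\mathrm S\}$ for $1\le i\le n+1$, one has $h_i\ge 0$ for all $i$ and $h_{n+1}=0$. An sr-Laguerre history of length $n$ is a triple $W=(w,h,c)$ where $w$ is a 2-Motzkin path of length $n$, $h=h_1\cdots h_n$ is its height sequence, and $c=c_1\cdots c_n$ is a sequence of integers with $0\le c_i\le h_i$ if $w_i\in\{\mathrm N,\mathrm E\}$ and $1\le c_i\le h_i$ if $w_i\in\{\mathrm S,\mathrm{dE}\}$. $\mathfrak L_n$ is the set of all of these; $\mathrm{cs}(W):=\max\{i\in[n]: c_i=0\}$. The map $\xi:\mathfrak L_n\to\mathfrak L_n$ is the unique involution such that for $W=(w,h,c)$ with $\mathrm{cs}(W)=m$ and $\xi(W)=(v,g,b)$: (1) $\mathrm{cs}(\xi(W))=n+1-m$; (2) for $j\ne n+1-m$, $v_j\in\{\mathrm N,\mathrm E\}$ iff $w_{n+1-j}\in\{\mathrm S,\mathrm{dE}\}$; (3) $g_j=h_{n+1-j}+1$ if $j>n+1-m$ and $v_j\in\{\mathrm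 S,\mathrm{dE}\}$, $g_j=h_{n+1-j}-1$ if $j<n+1-m$ and $v_j\in\{\mathrm N,\mathrm E\}$, and $g_j=h_{n+1-j}$ otherwise; (4) $b_j=g_j-h_{n+1-j}+c_{n+1-j}$ for all $j\in[n]$. The bijection $\Phi_{\mathrm{YZL}}:\mathfrak S_n\to\mathfrak L_n$. For $\pi\in\mathfrak S_n$ let $\mathrm{pone}(\pi)=\pi^{ -1}(1)$. Define $\Phi_{\mathrm{YZL}}(\pi)=(w,h,c)$ as follows. For $i\in[n-1]$ with $i\ne\mathrm{pone}(\pi)$: $w_i=\mathrm N$ if $i<\pi(i)$ and $i+1\le\pi^{ -1}(i+1)$; $w_i=\mathrm S$ if $i\ge\pi(i)$ and $i+1>\pi^{ -1}(i+1)$; $w_i=\mathrm E$ if $i<\pi(i)$ and $i+1>\pi^{ -1}(i+1)$; $w_i=\mathrm{dE}$ if $i\ge\pi(i)$ and $i+1\le\pi^{ -1}(i+1)$. If $i=\mathrm{pone}(\pi)\le n-1$: $w_i=\mathrm N$ if $i+1\le\pi^{ -1}(i+1)$ and $w_i=\mathrm E$ if $i+1>\pi^{ -1}(i+1)$. Finally $w_n=\mathrm S$ if $\mathrm{pone}(\pi)\ne n$ and $w_n=\mathrm E$ if $\mathrm{pone}(\pi)=n$. The sequence $h$ is the height sequence of $w$, and $c_i=\mathrm{vnest}_i(\pi)+\chi(w_i\in\{\mathrm S,\mathrm{dE}\})$ for $i\in[n]$ ($\chi$ is $1$ if the statement is true, $0$ otherwise), where $\mathrm{nest}_i(\pi)=\#\{j: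 j<i<\pi(i)<\pi(j)\text{ or }\pi(j)<\pi(i)\le i<j\}$ and $\mathrm{vnest}_i(\pi)=\mathrm{nest}_i(\pi)-1$ if $\pi(i)\le i$ and $i<\mathrm{pone}(\pi)$; $\mathrm{vnest}_i(\pi)=\mathrm{nest}_i(\pi)+1$ if $\pi(i)>i$ and $i>\mathrm{pone}(\pi)$; $\mathrm{vnest}_i(\pi)=\mathrm{nest}_i(\pi)$ otherwise. Permutation statistics. $\mathrm{Ep}(\pi)=\{i\in[n]:\pi(i)>i\}$; $\mathrm{Nep}(\pi)=\{i\in[n]:\pi(i)\le i\}$; $\mathrm{Exc}(\pi)=\{\pi(i):\pi(i)>i\}$; $\mathrm{Vnex}(\pi)=\{i\in[n-1]: i+1\notin\mathrm{Exc}(\pi)\}$. $\mathrm{Vnepb},\mathrm{Vepb}$ (resp. $\mathrm{Vnepa},\mathrm{Vepa}$) of $\pi$ are the subsets of $\mathrm{Nep}(\pi),\mathrm{Ep}(\pi)$ of the elements $i<\mathrm{pone}(\pi)$ (resp. $i>\mathrm{pone}(\pi)$). $\mathrm{Vedif}(\pi)$ is the multiset union (adding multiplicities) of the sets $\{i+1,\dots,\pi(i)-1\}$ over $i\in\mathrm{Ep}(\pi)$ together with $\{\mathrm{pone}(\pi)+1,\dots,n\}$. $\mathrm{Vnest}(\pi)$ is the multiset with $\mathrm{vnest}_i(\pi)$ copies of $i$ for each $i\in[n]$. -}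

module Defs where

open import Data.Bool using (if_then_else_)
open import Data.Empty using (⊥; ⊥-elim)
open import Data.Fin using (Fin; zero; suc; toℕ; fromℕ; fromℕ<; inject₁; opposite; _<_; _≤_; _<?_; _≤?_)
open import Data.Fin.Induction using (<-wellFounded; Acc; acc)
open import Data.Fin.Permutation
  using (Permutation′; permutation; _⟨$⟩ʳ_; _⟨$⟩ˡ_; _≈_; _∘ₚ_; flip; inverseˡ; inverseʳ; reverse; lift₀)
import Data.Fin.Properties as Fin
open import Data.Fin.Relation.Unary.Top using (View; view; ‵fromℕ; ‵inj₁; ‵inject₁; view-fromℕ; view-inject₁)
open import Data.List using (allFin; filter)
import Data.List.Extrema as Extrema
open import Data.List.Membership.Propositional.Properties using (∈-allFin; ∈-filter⁺; ∈-filter⁻)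
import Data.List.Relation.Unary.All as All
open import Data.Nat as ℕ using (ℕ; zero; suc; pred; _+_; _∸_; z≤n; s≤s)
import Data.Nat.Properties as ℕ
open import Data.Nat.Tactic.RingSolver using (solve-∀)
open import Data.Product using (Σ; ∃; _×_; _,_; proj₁; proj₂)
open import Data.Sum using (_⊎_; inj₁; inj₂)
open import Data.Unit using (⊤; tt)
open import Function using (_∘_)
open import Function.Bundles using (_⇔_; mk⇔)
open import Relation.Binary.Definitions using (Tri; tri<; tri≈; tri>)
open import Relation.Binary.PropositionalEquality
open import Relation.Nullary using (Dec; does; yes; no; ¬_; contradiction)
open import Relation.Nullary.Decidable using (_×-dec_; _⊎-dec_; ¬?)
open import Relation.Unary using (Decidable)
open import Algebra.Properties.CommutativeMonoid.Sum ℕ.+-0-commutativeMonoid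
  using (sum; sum-cong-≗; ∑-distrib-+; ∑-comm; sum-permute)

-- Conventions.  The element i of [n] = {1,…,n} is the j : Fin n with toℕ j = i − 1.
-- Hence `zero` is 1, `fromℕ k` is n = suc k, `opposite` is i ↦ n + 1 − i, and for
-- j : Fin k representing i ∈ [n−1], the elements i and i + 1 of [n] are `inject₁ j`
-- and `suc j`.  Likewise `height w p` is h_{p+1}.

χ : {A : Set} → Dec A → ℕ
χ d = if does d then 1 else 0

# : ∀ {n} {P : Fin n → Set} → Decidable P → ℕ
# P? = sum (λ i → χ (P? i))

------------------------------------------------------------------------
-- Laguerre histories

data Step : Set where
  N S E dE : Step

data NE : Step → Set where
  N : NE N
  E : NE E

data SdE : Step → Set where
  S  : SdE S
  dE : SdE dE

_≟_ : (s t : Step) → Dec (s ≡ t)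
N  ≟ N  = yes refl
N  ≟ S  = no λ ()
N  ≟ E  = no λ ()
N  ≟ dE = no λ ()
S  ≟ N  = no λ ()
S  ≟ S  = yes refl
S  ≟ E  = no λ ()
S  ≟ dE = no λ ()
E  ≟ N  = no λ ()
E  ≟ S  = no λ ()
E  ≟ E  = yes refl
E  ≟ dE = no λ ()
dE ≟ N  = no λ ()
dE ≟ S  = no λ ()
dE ≟ E  = no λ ()
dE ≟ dE = yes refl

SdE? : Decidable SdE
SdE? N  = no λ ()
SdE? S  = yes S
SdE? E  = no λ ()
SdE? dE = yes dE

NE? : Decidable NE
NE? N  = yes N
NE? S  = no λ ()
NE? E  = yes E
NE? dE = no λ ()

-- Number of occurrences of s among the first p letters.
before : ∀ {n} → (Fin n → Step) → Step → ℕ → ℕ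
before w s p = # (λ j → (toℕ j ℕ.<? p) ×-dec (w j ≟ s))

-- The truncated subtraction is exact on 2-Motzkin paths, by `nonneg` below.
height : ∀ {n} → (Fin n → Step) → ℕ → ℕ
height w p = before w N p ∸ before w S p

record 𝔏 (n : ℕ) : Set where
  field
    step      : Fin n → Step
    nonneg    : ∀ p → p ℕ.≤ n → before step S p ℕ.≤ before step N p
    closed    : before step S n ≡ before step N n
    label     : Fin n → ℕ
    label-NE  : ∀ i → NE (step i) → label i ℕ.≤ height step (toℕ i)
    label-SdE : ∀ i → SdE (step i) → 1 ℕ.≤ label i × label i ℕ.≤ height step (toℕ i)

  h : Fin n → ℕ
  h i = height step (toℕ i)

open 𝔏

infix 4 _≋_

_≋_ : ∀ {n} → 𝔏 n → 𝔏 n → Set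
W ≋ V = (∀ i → step W i ≡ step V i) × (∀ i → label W i ≡ label V i)

-- The default `zero` of `max` is itself a member of the list: the first label is
-- always 0, since the first height is 0.
cs : ∀ {k} → 𝔏 (suc k) → Fin (suc k)
cs {k} W = max zero (filter (λ i → label W i ℕ.≟ 0) (allFin (suc k)))
  where open Extrema (Fin.≤-totalOrder (suc k)) using (max)

-- The defining properties of ξ; such a ξ exists, see `ξ₀-isXi` at the end.
record IsXi {k} (ξ : 𝔏 (suc k) → 𝔏 (suc k)) : Set where
  field
    involutive : ∀ W → ξ (ξ W) ≋ W
    cs-ξ : ∀ W → cs (ξ W) ≡ opposite (cs W)
    step-ξ : ∀ W j → j ≢ opposite (cs W) → NE (step (ξ W) j) ⇔ SdE (step W (opposite j))
    h-up : ∀ W j → opposite (cs W) < j → SdE (step (ξ W) j) → h (ξ W) j ≡ h W (opposite j) + 1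
    h-down : ∀ W j → j < opposite (cs W) → NE (step (ξ W) j) → h (ξ W) j + 1 ≡ h W (opposite j)
    h-same : ∀ W j → ¬ (opposite (cs W) < j × SdE (step (ξ W) j)) → ¬ (j < opposite (cs W) × NE (step (ξ W) j)) →
             h (ξ W) j ≡ h W (opposite j)
    -- b_j = g_j − h_{n+1−j} + c_{n+1−j}, with the subtracted term moved to the left
    label-ξ : ∀ W j → label (ξ W) j + h W (opposite j) ≡ h (ξ W) j + label W (opposite j)

------------------------------------------------------------------------
-- Permutations

𝔖 : ℕ → Set
𝔖 = Permutation′

pone : ∀ {k} → 𝔖 (suc k) → Fin (suc k)
pone π = π ⟨$⟩ˡ zero

-- In the first case of vnest, pone π is one of the j counted by nest π i, so `∸` is exact.
nest vnest : ∀ {k} → 𝔖 (suc k) → Fin (suc k) → ℕ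
nest π i = # (λ j →
         ((j <? i) ×-dec ((i <? π ⟨$⟩ʳ i) ×-dec (π ⟨$⟩ʳ i <? π ⟨$⟩ʳ j)))
  ⊎-dec  ((π ⟨$⟩ʳ j <? π ⟨$⟩ʳ i) ×-dec ((π ⟨$⟩ʳ i ≤? i) ×-dec (i <? j))))
vnest π i =
  if does ((π ⟨$⟩ʳ i ≤? i) ×-dec (i <? pone π)) then nest π i ∸ 1
  else if does ((i <? π ⟨$⟩ʳ i) ×-dec (pone π <? i)) then nest π i + 1
  else nest π i

stepAt : ∀ {k} → 𝔖 (suc k) → {i : Fin (suc k)} → View i → Step
stepAt {k} π ‵fromℕ = if does (pone π Fin.≟ fromℕ k) then E else S
stepAt π (‵inject₁ i) =
  if does (inject₁ i Fin.≟ pone π)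
  then (if does (suc i ≤? π ⟨$⟩ˡ suc i) then N else E)
  else if does (inject₁ i <? π ⟨$⟩ʳ inject₁ i)
       then (if does (suc i ≤? π ⟨$⟩ˡ suc i) then N else E)
       else (if does (suc i ≤? π ⟨$⟩ˡ suc i) then dE else S)

Φ-step : ∀ {k} → 𝔖 (suc k) → Fin (suc k) → Step
Φ-step π i = stepAt π (view i)

Φ-label : ∀ {k} → 𝔖 (suc k) → Fin (suc k) → ℕ
Φ-label π i = vnest π i + χ (SdE? (Φ-step π i))

-- Multisets with elements in [n], by multiplicities; a set is its indicator function.
Multiset : ℕ → Set
Multiset n = Fin n → ℕ

infix 4 _≐_
infixl 6 _⊔_ _∖_

_≐_ : ∀ {n} → Multiset n → Multiset n → Set
A ≐ B = ∀ i → A i ≡ B i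

_⊔_ _∖_ : ∀ {n} → Multiset n → Multiset n → Multiset n
(A ⊔ B) i = A i + B i
(A ∖ B) i = A i ∸ B i

-- For a multiset on [N−1], replacing s by N − s is composing with `opposite`.
κ : ∀ N → Multiset (pred N) → Multiset (pred N)
κ _ A i = A (opposite i)

interval : ∀ n → Multiset n
interval n i = 1

Exc : ∀ {k} → 𝔖 (suc k) → Fin (suc k) → Set
Exc π v = ∃ λ i → i < π ⟨$⟩ʳ i × π ⟨$⟩ʳ i ≡ v

Exc? : ∀ {k} (π : 𝔖 (suc k)) → Decidable (Exc π)
Exc? π v = Fin.any? (λ i → (i <? π ⟨$⟩ʳ i) ×-dec (π ⟨$⟩ʳ i Fin.≟ v))

module _ {k} (π : 𝔖 (suc k)) where

  Ep? : Decidable (λ i → i < π ⟨$⟩ʳ i)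
  Ep? i = i <? π ⟨$⟩ʳ i

  Nep? : Decidable (λ i → π ⟨$⟩ʳ i ≤ i)
  Nep? i = π ⟨$⟩ʳ i ≤? i

  Vnepb Vnepa Vepb Vepa Vnest Vedif : Multiset (suc k)
  Vnepb i = χ (Nep? i ×-dec (i <? pone π))
  Vnepa i = χ (Nep? i ×-dec (pone π <? i))
  Vepb  i = χ (Ep? i ×-dec (i <? pone π))
  Vepa  i = χ (Ep? i ×-dec (pone π <? i))
  Vnest i = vnest π i
  Vedif v = # (λ i → Ep? i ×-dec ((i <? v) ×-dec (v <? π ⟨$⟩ʳ i))) + χ (pone π <? v)

  Vnex : Multiset k
  Vnex i = χ (¬? (Exc? π (suc i)))

------------------------------------------------------------------------
-- Φ maps into 𝔏 and is bijective.  Composing π with the cyclic shift 1 ↦ n, v ↦ v − 1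
-- gives a τ for which w_i ∈ {N,E} iff i ≤ τ(i), and c_i counts the j < i with
-- τ(j) > τ(i), respectively 1 plus the number of j > i with τ(j) < τ(i) (see `Coded`).

χ-cong : {A B : Set} (a : Dec A) (b : Dec B) → (A → B) → (B → A) → χ a ≡ χ b
χ-cong (yes a) (yes b) f g = refl
χ-cong (yes a) (no ¬b) f g = contradiction (f a) ¬b
χ-cong (no ¬a) (yes b) f g = contradiction (g b) ¬a
χ-cong (no ¬a) (no ¬b) f g = refl

χ-⊎ : {A B C : Set} (a : Dec A) (b : Dec B) (c : Dec C) →
      (A → B ⊎ C) → (B → A) → (C → A) → (B → C → ⊥) → χ a ≡ χ b + χ c
χ-⊎ (yes a) (yes b) (yes c) f g h d = ⊥-elim (d b c)
χ-⊎ (yes a) (yes b) (no ¬c) f g h d = refl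
χ-⊎ (yes a) (no ¬b) (yes c) f g h d = refl
χ-⊎ (yes a) (no ¬b) (no ¬c) f g h d with f a
... | inj₁ b = contradiction b ¬b
... | inj₂ c = contradiction c ¬c
χ-⊎ (no ¬a) (yes b) c f g h d = contradiction (g b) ¬a
χ-⊎ (no ¬a) (no ¬b) (yes c) f g h d = contradiction (h c) ¬a
χ-⊎ (no ¬a) (no ¬b) (no ¬c) f g h d = refl

χ-yes : {A : Set} (a : Dec A) → A → χ a ≡ 1
χ-yes (yes _) _ = refl
χ-yes (no ¬a) a = contradiction a ¬a

χ-no : {A : Set} (a : Dec A) → ¬ A → χ a ≡ 0
χ-no (yes a) ¬a = contradiction a ¬a
χ-no (no _) _ = refl

module _ {n} {P Q : Fin n → Set} (P? : Decidable P) (Q? : Decidable Q) where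

  #-cong : (∀ i → P i → Q i) → (∀ i → Q i → P i) → # P? ≡ # Q?
  #-cong f g = sum-cong-≗ (λ i → χ-cong (P? i) (Q? i) (f i) (g i))

  #-⊎ : {R : Fin n → Set} (R? : Decidable R) →
        (∀ i → P i → Q i ⊎ R i) → (∀ i → Q i → P i) → (∀ i → R i → P i) →
        (∀ i → Q i → R i → ⊥) → # P? ≡ # Q? + # R?
  #-⊎ R? f g h d = trans
    (sum-cong-≗ (λ i → χ-⊎ (P? i) (Q? i) (R? i) (f i) (g i) (h i) (d i)))
    (∑-distrib-+ (λ i → χ (Q? i)) (λ i → χ (R? i)))

#-none : ∀ {n} {P : Fin n → Set} (P? : Decidable P) → (∀ i → ¬ P i) → # P? ≡ 0
#-none {zero} P? e = refl
#-none {suc n} P? e rewrite χ-no (P? zero) (e zero) = #-none (P? ∘ suc) (e ∘ suc)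

#-one : ∀ {n} {P : Fin n → Set} (P? : Decidable P) i → P i → (∀ j → P j → j ≡ i) → # P? ≡ 1
#-one P? zero p u rewrite χ-yes (P? zero) p =
  cong suc (#-none (P? ∘ suc) (λ j q → contradiction (u (suc j) q) λ ()))
#-one P? (suc i) p u rewrite χ-no (P? zero) (λ q → contradiction (u zero q) λ ()) =
  #-one (P? ∘ suc) i p (λ j q → Fin.suc-injective (u (suc j) q))

#-⊆ : ∀ {n} {P Q : Fin n → Set} (P? : Decidable P) (Q? : Decidable Q) →
      (∀ i → P i → Q i) → # P? ℕ.≤ # Q?
#-⊆ P? Q? f = ℕ.≤-trans (ℕ.m≤m+n _ (# R?)) (ℕ.≤-reflexive (sym
    (#-⊎ Q? P? R? (λ i q → g i q (P? i)) f (λ _ → proj₁) (λ _ p → λ (_ , ¬p) → ¬p p))))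
  where
  R? = λ i → Q? i ×-dec ¬? (P? i)
  g : ∀ i → _ → Dec _ → _
  g i q (yes p) = inj₁ p
  g i q (no ¬p) = inj₂ (q , ¬p)

#-⊂ : ∀ {n} {P Q : Fin n → Set} (P? : Decidable P) (Q? : Decidable Q) →
      (∀ i → P i → Q i) → (i : Fin n) → Q i → ¬ P i → # P? ℕ.< # Q?
#-⊂ {P = P} P? Q? f i q ¬p = ℕ.≤-trans (ℕ.≤-reflexive eq) (#-⊆ R? Q? sub)
  where
  R? : Decidable (λ j → P j ⊎ j ≡ i)
  R? j with P? j | j Fin.≟ i
  ... | yes p | _ = yes (inj₁ p)
  ... | no ¬p | yes e = yes (inj₂ e)
  ... | no ¬p | no ¬e = no λ { (inj₁ p) → ¬p p ; (inj₂ e) → ¬e e }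
  sub : ∀ j → P j ⊎ j ≡ i → _
  sub j (inj₁ p) = f j p
  sub j (inj₂ refl) = q
  eq : suc (# P?) ≡ # R?
  eq = trans (ℕ.+-comm 1 _) (trans
    (cong (# P? +_) (sym (#-one (Fin._≟ i) i refl (λ _ e → e))))
    (sym (#-⊎ R? P? (Fin._≟ i) (λ _ r → r) (λ _ → inj₁) (λ _ → inj₂) λ { j p refl → ¬p p })))

#-permute : ∀ {n} {P : Fin n → Set} (P? : Decidable P) (τ : Permutation′ n) →
            # P? ≡ # (λ i → P? (τ ⟨$⟩ʳ i))
#-permute P? τ = sum-permute (λ i → χ (P? i)) τ

#-pos : ∀ {n} {P : Fin n → Set} (P? : Decidable P) i → P i → 0 ℕ.< # P?
#-pos P? i p = ℕ.≤-trans (ℕ.≤-reflexive (sym (#-one (Fin._≟ i) i refl (λ _ e → e))))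
  (#-⊆ (Fin._≟ i) P? (λ { _ refl → p }))

#-image : ∀ {n} {J Q : Fin n → Set} (J? : Decidable J) (Q? : Decidable Q) (f : Fin n → Fin n) →
          (∀ i j → J i → J j → f i ≡ f j → i ≡ j) →
          # Q? ≡ # (λ v → Q? v ×-dec ¬? (Fin.any? (λ j → J? j ×-dec (f j Fin.≟ v))))
               + # (λ j → J? j ×-dec Q? (f j))
#-image {n} {J} {Q} J? Q? f inj = trans
  (#-⊎ Q? (λ v → Q? v ×-dec ¬? (im? v)) (λ v → Q? v ×-dec im? v)
    (λ v q → g v q (im? v)) (λ _ → proj₁) (λ _ → proj₁) (λ v (_ , ¬a) (_ , a) → ¬a a))
  (cong (# (λ v → Q? v ×-dec ¬? (im? v)) +_) (trans (sum-cong-≗ row) (trans (∑-comm C) (sum-cong-≗ col))))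
  where
  im? : ∀ v → Dec (∃ λ j → J j × f j ≡ v)
  im? v = Fin.any? (λ j → J? j ×-dec (f j Fin.≟ v))
  g : ∀ v → Q v → Dec _ → _
  g v q (yes a) = inj₂ (q , a)
  g v q (no ¬a) = inj₁ (q , ¬a)
  C? : ∀ v j → Dec ((J j × Q (f j)) × f j ≡ v)
  C? v j = (J? j ×-dec Q? (f j)) ×-dec (f j Fin.≟ v)
  C : Fin n → Fin n → ℕ
  C v j = χ (C? v j)
  row : ∀ v → χ (Q? v ×-dec im? v) ≡ # (C? v)
  row v = go (Q? v ×-dec im? v)
    where
    go : (d : Dec (Q v × ∃ λ j → J j × f j ≡ v)) → χ d ≡ # (C? v)
    go (yes (q , j , a , refl)) = sym (#-one (C? v) j ((a , q) , refl) (λ i ((b , _) , e) → inj i j b a e))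
    go (no ¬qa) = sym (#-none (C? v) λ { j ((a , q) , refl) → ¬qa (q , j , a , refl) })
  col : ∀ j → # (λ v → C? v j) ≡ χ (J? j ×-dec Q? (f j))
  col j = go (J? j ×-dec Q? (f j))
    where
    go : (d : Dec (J j × Q (f j))) → # (λ v → C? v j) ≡ χ d
    go (yes a) = #-one (λ v → C? v j) (f j) (a , refl) (λ v (_ , e) → sym e)
    go (no ¬a) = #-none (λ v → C? v j) (λ v (a , _) → ¬a a)

nth : ∀ {n} {P : Fin n → Set} (P? : Decidable P) c → c ℕ.< # P? →
      ∃ λ v → P v × # (λ u → P? u ×-dec (u <? v)) ≡ c
nth {suc n} {P} P? c lt = go (P? zero) refl c lt
  where
  shift : ∀ v → # (λ u → P? (suc u) ×-dec (suc u <? suc v)) ≡ # (λ u → P? (suc u) ×-dec (u <? v))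
  shift v = #-cong (λ u → P? (suc u) ×-dec (suc u <? suc v)) (λ u → P? (suc u) ×-dec (u <? v))
    (λ { u (a , s≤s b) → a , b}) (λ { u (a , b) → a , s≤s b})
  go : (d : Dec (P zero)) → χ (P? zero) ≡ χ d → ∀ c → c ℕ.< # P? →
       ∃ λ v → P v × # (λ u → P? u ×-dec (u <? v)) ≡ c
  go (yes p) e zero lt = zero , p , #-none (λ u → P? u ×-dec (u <? zero {n})) (λ { u (_ , ()) })
  go (yes p) e (suc c) lt =
    let v , q , r = nth (P? ∘ suc) c (ℕ.≤-pred (subst (λ x → suc c ℕ.< x + # (P? ∘ suc)) e lt)) in
    suc v , q , cong₂ _+_ (χ-yes (P? zero ×-dec (zero {n} <? suc v)) (p , s≤s z≤n)) (trans (shift v) r)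
  go (no ¬p) e c lt =
    let v , q , r = nth (P? ∘ suc) c (subst (λ x → c ℕ.< x + # (P? ∘ suc)) e lt) in
    suc v , q , cong₂ _+_ (χ-no (P? zero ×-dec (zero {n} <? suc v)) (¬p ∘ proj₁)) (trans (shift v) r)

injective⇒permutation : ∀ {n} (f : Fin n → Fin n) → (∀ i j → f i ≡ f j → i ≡ j) →
                        Σ (Permutation′ n) λ τ → ∀ i → τ ⟨$⟩ʳ i ≡ f i
injective⇒permutation {n} f inj = permutation f (λ v → proj₁ (pre v)) (λ v → proj₂ (pre v)) (λ i → inj _ _ (proj₂ (pre (f i)))) , λ _ → refl
  where
  T? : Decidable {A = Fin n} (λ _ → ⊤)
  T? _ = yes tt
  im? = λ v → Fin.any? (λ j → T? j ×-dec (f j Fin.≟ v))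
  eq : # T? ≡ # (λ v → T? v ×-dec ¬? (im? v)) + # T?
  eq = trans (#-image T? T? f (λ i j _ _ → inj i j)) refl
  pre : ∀ v → ∃ λ j → f j ≡ v
  pre v with im? v
  ... | yes (j , _ , e) = j , e
  ... | no ¬a = contradiction (ℕ.+-cancelʳ-≡ (# T?) 0 (# (λ v → T? v ×-dec ¬? (im? v))) eq)
    (ℕ.<⇒≢ (#-pos (λ v → T? v ×-dec ¬? (im? v)) v (tt , ¬a)))

-- An injection f from U to V for which c i is the number of v ∈ V with v < f i that
-- are not values of f at positions < i: choose f i greedily, in increasing order of i.
module _ {n} {U V : Fin n → Set} (U? : Decidable U) (V? : Decidable V)
         {ok : Fin n → Fin n → Set} (ok? : ∀ i v → Dec (ok i v))
         (mono₁ : ∀ {i j v} → i < j → ok i v → ok j v)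
         (mono₂ : ∀ {i u v} → u < v → ok i v → ok i u)
         (c : Fin n → ℕ)
         (bound : ∀ i → U i → c i + # (λ j → U? j ×-dec (j <? i)) ℕ.< # (λ v → V? v ×-dec ok? i v))
         where

  Good : (Fin n → Fin n) → ℕ → Set
  Good f m =
    (∀ i → toℕ i ℕ.< m → U i → V (f i) × ok i (f i)) ×
    (∀ i j → toℕ i ℕ.< m → toℕ j ℕ.< m → U i → U j → f i ≡ f j → i ≡ j) ×
    (∀ i → toℕ i ℕ.< m → U i →
       c i + # (λ j → (U? j ×-dec (j <? i)) ×-dec (f j <? f i)) ≡ # (λ v → V? v ×-dec (v <? f i)))

  module Extend (i : Fin n) (u : U i) (f : Fin n → Fin n) (good : Good f (toℕ i)) where
    J? = λ j → U? j ×-dec (j <? i)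
    Q? = λ v → V? v ×-dec ok? i v
    im? = λ v → Fin.any? (λ j → J? j ×-dec (f j Fin.≟ v))
    A? = λ v → Q? v ×-dec ¬? (im? v)
    injJ : ∀ a b → U a × a < i → U b × b < i → f a ≡ f b → a ≡ b
    injJ a b (ua , la) (ub , lb) e = proj₁ (proj₂ good) a b la lb ua ub e
    count : c i ℕ.< # A?
    count = ℕ.+-cancelʳ-< (# J?) (c i) (# A?) (ℕ.≤-trans (bound i u) (ℕ.≤-reflexive (trans
      (#-image J? Q? f injJ)
      (cong (# A? +_) (#-cong (λ j → J? j ×-dec Q? (f j)) J? (λ _ → proj₁)
        (λ j (uj , l) → let (p , q) = proj₁ good j l uj in (uj , l) , p , mono₁ l q))))))
    chosen = nth A? (c i) count
    v = proj₁ chosen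
    Vv = proj₁ (proj₁ (proj₁ (proj₂ chosen)))
    okv = proj₂ (proj₁ (proj₁ (proj₂ chosen)))
    new = proj₂ (proj₁ (proj₂ chosen))
    f′ : Fin n → Fin n
    f′ j = if does (j Fin.≟ i) then v else f j
    at-i : f′ i ≡ v
    at-i with i Fin.≟ i
    ... | yes _ = refl
    ... | no ¬e = contradiction refl ¬e
    at-< : ∀ j → j < i → f′ j ≡ f j
    at-< j l with j Fin.≟ i
    ... | yes refl = contradiction l (ℕ.<-irrefl refl)
    ... | no _ = refl
    cases : ∀ j → toℕ j ℕ.< suc (toℕ i) → j < i ⊎ j ≡ i
    cases j l with ℕ.m<1+n⇒m<n∨m≡n l
    ... | inj₁ l = inj₁ l
    ... | inj₂ e = inj₂ (Fin.toℕ-injective e)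
    g₁ : ∀ j → toℕ j ℕ.< suc (toℕ i) → U j → V (f′ j) × ok j (f′ j)
    g₁ j l uj with cases j l
    ... | inj₁ l rewrite at-< j l = proj₁ good j l uj
    ... | inj₂ refl rewrite at-i = Vv , okv
    g₂ : ∀ a b → toℕ a ℕ.< suc (toℕ i) → toℕ b ℕ.< suc (toℕ i) → U a → U b → f′ a ≡ f′ b → a ≡ b
    g₂ a b la lb ua ub e with cases a la | cases b lb
    ... | inj₁ la | inj₁ lb rewrite at-< a la | at-< b lb = injJ a b (ua , la) (ub , lb) e
    ... | inj₁ la | inj₂ refl rewrite at-< a la | at-i = contradiction (a , (ua , la) , e) new
    ... | inj₂ refl | inj₁ lb rewrite at-< b lb | at-i = contradiction (b , (ub , lb) , sym e) new
    ... | inj₂ refl | inj₂ refl = refl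
    old : ∀ a → (a < i ⊎ a ≡ i) → ∀ w → w ≡ f′ a →
      # (λ j → (U? j ×-dec (j <? a)) ×-dec (f j <? w)) ≡ # (λ j → (U? j ×-dec (j <? a)) ×-dec (f′ j <? f′ a))
    old a a≤i w refl = #-cong (λ j → (U? j ×-dec (j <? a)) ×-dec (f j <? w)) (λ j → (U? j ×-dec (j <? a)) ×-dec (f′ j <? f′ a))
      (λ j ((uj , l) , p) → (uj , l) , subst (_< w) (sym (at-< j (lt j l a≤i))) p)
      (λ j ((uj , l) , p) → (uj , l) , subst (_< w) (at-< j (lt j l a≤i)) p)
      where
      lt : ∀ j → j < a → a < i ⊎ a ≡ i → j < i
      lt j l (inj₁ m) = ℕ.<-trans l m
      lt j l (inj₂ refl) = l
    g₃ : ∀ a → toℕ a ℕ.< suc (toℕ i) → U a →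
       c a + # (λ j → (U? j ×-dec (j <? a)) ×-dec (f′ j <? f′ a)) ≡ # (λ v → V? v ×-dec (v <? f′ a))
    g₃ a la ua with cases a la
    ... | inj₁ l = trans (cong (c a +_) (sym (old a (inj₁ l) (f a) (sym (at-< a l)))))
      (subst (λ w → c a + # (λ j → (U? j ×-dec (j <? a)) ×-dec (f j <? f a)) ≡ # (λ v → V? v ×-dec (v <? w)))
        (sym (at-< a l)) (proj₂ (proj₂ good) a l ua))
    ... | inj₂ refl = trans (cong (c i +_) (sym (old i (inj₂ refl) v (sym at-i))))
      (subst (λ w → c i + # (λ j → J? j ×-dec (f j <? v)) ≡ # (λ v → V? v ×-dec (v <? w))) (sym at-i)
        (sym (trans (#-image J? (λ u → V? u ×-dec (u <? v)) f injJ)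
          (cong₂ _+_
            (trans (#-cong (λ u → (V? u ×-dec (u <? v)) ×-dec ¬? (im? u)) (λ u → A? u ×-dec (u <? v))
               (λ w ((p , l) , ¬m) → ((p , mono₂ l okv) , ¬m) , l)
               (λ w (((p , _) , ¬m) , l) → (p , l) , ¬m))
             (proj₂ (proj₂ chosen)))
            (#-cong (λ j → J? j ×-dec (V? (f j) ×-dec (f j <? v))) (λ j → J? j ×-dec (f j <? v))
               (λ j (p , _ , l) → p , l)
               (λ j ((uj , l) , m) → (uj , l) , proj₁ (proj₁ good j l uj) , m))))))

  matching-upto : ∀ m → m ℕ.≤ n → Σ (Fin n → Fin n) λ f → Good f m
  matching-upto zero _ = (λ i → i) , (λ _ ()) , (λ _ _ ()) , (λ _ ())
  matching-upto (suc m) lt = subst (λ m → Σ (Fin n → Fin n) λ f → Good f (suc m)) (Fin.toℕ-fromℕ< lt)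
      (go (subst (λ m → Σ (Fin n → Fin n) λ f → Good f m) (sym (Fin.toℕ-fromℕ< lt)) (matching-upto m (ℕ.<⇒≤ lt))) (U? i))
    where
    i = fromℕ< lt
    go : (Σ (Fin n → Fin n) λ f → Good f (toℕ i)) → Dec (U i) → Σ (Fin n → Fin n) λ f → Good f (suc (toℕ i))
    go (f , good) (yes u) = let open Extend i u f good in f′ , g₁ , g₂ , g₃
    go (f , a , b , d) (no ¬u) = f , (λ j l u → a j (below j l u) u) ,
        (λ j k l l′ u u′ → b j k (below j l u) (below k l′ u′) u u′) , (λ j l u → d j (below j l u) u)
      where
      below : ∀ j → toℕ j ℕ.< suc (toℕ i) → U j → j < i
      below j l u with ℕ.m<1+n⇒m<n∨m≡n l
      ... | inj₁ l = l
      ... | inj₂ e = contradiction (subst U (Fin.toℕ-injective e) u) ¬u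

  matching : Σ (Fin n → Fin n) λ f →
    (∀ i → U i → V (f i) × ok i (f i)) ×
    (∀ i j → U i → U j → f i ≡ f j → i ≡ j) ×
    (∀ i → U i → c i + # (λ j → (U? j ×-dec (j <? i)) ×-dec (f j <? f i)) ≡ # (λ v → V? v ×-dec (v <? f i)))
  matching = let f , a , b , d = matching-upto n ℕ.≤-refl in
    f , (λ i → a i (Fin.toℕ<n i)) , (λ i j → b i j (Fin.toℕ<n i) (Fin.toℕ<n j)) , (λ i → d i (Fin.toℕ<n i))

module _ {n} {U V : Fin n → Set} (U? : Decidable U) (τ σ : Permutation′ n)
         (UVτ : ∀ i → U i → V (τ ⟨$⟩ʳ i)) (VUτ : ∀ v → V v → U (τ ⟨$⟩ˡ v))
         (UVσ : ∀ i → U i → V (σ ⟨$⟩ʳ i)) (VUσ : ∀ v → V v → U (σ ⟨$⟩ˡ v)) where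

  smaller : ∀ i → U i → (∀ j → j < i → U j → τ ⟨$⟩ʳ j ≡ σ ⟨$⟩ʳ j) → τ ⟨$⟩ʳ i < σ ⟨$⟩ʳ i →
    # (λ j → U? j ×-dec ((i <? j) ×-dec (τ ⟨$⟩ʳ j <? τ ⟨$⟩ʳ i)))
      ℕ.< # (λ j → U? j ×-dec ((i <? j) ×-dec (σ ⟨$⟩ʳ j <? σ ⟨$⟩ʳ i)))
  smaller i u agree lt = subst₂ ℕ._<_ (sym (#-permute Pτ (flip τ))) (sym (#-permute Pσ (flip σ)))
    (#-⊂ (λ v → Pτ (τ ⟨$⟩ˡ v)) (λ v → Pσ (σ ⟨$⟩ˡ v))
      (λ v (uv , l , m) → let v<τi = subst (_< τ ⟨$⟩ʳ i) (inverseʳ τ) m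
                              Uσv = VUσ v (subst V (inverseʳ τ) (UVτ _ uv)) in
         Uσv , later v Uσv (λ e → ℕ.<-asym v<τi (subst (τ ⟨$⟩ʳ i <_) (trans (cong (σ ⟨$⟩ʳ_) e) (inverseʳ σ)) lt))
                 (λ k e → ℕ.<-asym l (subst (_< i) (trans (sym (inverseˡ τ)) (cong (τ ⟨$⟩ˡ_) e)) k))
         , subst (_< σ ⟨$⟩ʳ i) (sym (inverseʳ σ)) (ℕ.<-trans v<τi lt))
      (τ ⟨$⟩ʳ i)
      (let Uk = VUσ _ (UVτ i u) in
         Uk , later _ Uk (λ e → ℕ.<-irrefl (cong toℕ (sym (trans (cong (σ ⟨$⟩ʳ_) e) (inverseʳ σ)))) lt)
                (λ k e → ℕ.<-irrefl (cong toℕ (trans (sym (inverseˡ τ)) (trans (cong (τ ⟨$⟩ˡ_) e) (inverseˡ τ)))) k)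
         , subst (_< σ ⟨$⟩ʳ i) (sym (inverseʳ σ)) lt)
      (λ (_ , l , _) → ℕ.<-irrefl (cong toℕ (sym (inverseˡ τ))) l))
    where
    Pτ = λ j → U? j ×-dec ((i <? j) ×-dec (τ ⟨$⟩ʳ j <? τ ⟨$⟩ʳ i))
    Pσ = λ j → U? j ×-dec ((i <? j) ×-dec (σ ⟨$⟩ʳ j <? σ ⟨$⟩ʳ i))
    later : ∀ v → U (σ ⟨$⟩ˡ v) → ¬ (i ≡ σ ⟨$⟩ˡ v) → (σ ⟨$⟩ˡ v < i → τ ⟨$⟩ʳ (σ ⟨$⟩ˡ v) ≡ v → ⊥) → i < σ ⟨$⟩ˡ v
    later v uv ¬e ¬k with Fin.<-cmp i (σ ⟨$⟩ˡ v)
    ... | tri< l _ _ = l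
    ... | tri≈ _ e _ = contradiction e ¬e
    ... | tri> _ _ k = ⊥-elim (¬k k (trans (agree _ k uv) (inverseʳ σ)))

agree : ∀ {n} {U V : Fin n → Set} (U? : Decidable U) (τ σ : Permutation′ n) →
  (∀ i → U i → V (τ ⟨$⟩ʳ i)) → (∀ v → V v → U (τ ⟨$⟩ˡ v)) →
  (∀ i → U i → V (σ ⟨$⟩ʳ i)) → (∀ v → V v → U (σ ⟨$⟩ˡ v)) →
  (∀ i → U i → # (λ j → U? j ×-dec ((i <? j) ×-dec (τ ⟨$⟩ʳ j <? τ ⟨$⟩ʳ i)))
             ≡ # (λ j → U? j ×-dec ((i <? j) ×-dec (σ ⟨$⟩ʳ j <? σ ⟨$⟩ʳ i)))) →
  ∀ i → U i → τ ⟨$⟩ʳ i ≡ σ ⟨$⟩ʳ i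
agree {U = U} {V} U? τ σ a b c d e i = go i (<-wellFounded i)
  where
  go : ∀ i → Acc _<_ i → U i → τ ⟨$⟩ʳ i ≡ σ ⟨$⟩ʳ i
  go i (acc rs) u with Fin.<-cmp (τ ⟨$⟩ʳ i) (σ ⟨$⟩ʳ i)
  ... | tri≈ _ p _ = p
  ... | tri< l _ _ = contradiction (smaller {V = V} U? τ σ a b c d i u (λ j k uj → go j (rs k) uj) l) (ℕ.<-irrefl (e i u))
  ... | tri> _ _ l = contradiction (smaller {V = V} U? σ τ c d a b i u (λ j k uj → sym (go j (rs k) uj)) l) (ℕ.<-irrefl (sym (e i u)))

-- w_i is S or E iff i = n or i + 1 is an excedance value.
data ES : Step → Set where
  E : ES E
  S : ES S

ES? : Decidable ES
ES? N  = no λ ()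
ES? S  = yes S
ES? E  = yes E
ES? dE = no λ ()

¬NE⇒SdE : ∀ {s} → ¬ NE s → SdE s
¬NE⇒SdE {N} x = contradiction N x
¬NE⇒SdE {S} x = S
¬NE⇒SdE {E} x = contradiction E x
¬NE⇒SdE {dE} x = dE

SdE⇒¬NE : ∀ {s} → SdE s → ¬ NE s
SdE⇒¬NE S ()
SdE⇒¬NE dE ()

step-unique : ∀ {s t} → (NE s → NE t) → (NE t → NE s) → (ES s → ES t) → (ES t → ES s) → s ≡ t
step-unique {N} {N} a b c d = refl
step-unique {N} {S} a b c d with () ← a N
step-unique {N} {E} a b c d with () ← d E
step-unique {N} {dE} a b c d with () ← a N
step-unique {S} {N} a b c d with () ← b N
step-unique {S} {S} a b c d = refl
step-unique {S} {E} a b c d with () ← b E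
step-unique {S} {dE} a b c d with () ← c S
step-unique {E} {N} a b c d with () ← c E
step-unique {E} {S} a b c d with () ← a E
step-unique {E} {E} a b c d = refl
step-unique {E} {dE} a b c d with () ← a E
step-unique {dE} {N} a b c d with () ← b N
step-unique {dE} {S} a b c d with () ← d S
step-unique {dE} {E} a b c d with () ← b E
step-unique {dE} {dE} a b c d = refl

#NE<-split : ∀ {n} (w : Fin n → Step) p →
  # (λ j → (toℕ j ℕ.<? p) ×-dec NE? (w j)) ≡ before w N p + before w E p
#NE<-split w p = #-⊎ (λ j → (toℕ j ℕ.<? p) ×-dec NE? (w j)) (λ j → (toℕ j ℕ.<? p) ×-dec (w j ≟ N)) (λ j → (toℕ j ℕ.<? p) ×-dec (w j ≟ E))
  (λ j (l , x) → f l x) (λ j (l , e) → l , subst NE (sym e) N) (λ j (l , e) → l , subst NE (sym e) E)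
  (λ j (_ , e) (_ , e′) → contradiction (trans (sym e) e′) λ ())
  where
  f : ∀ {A : Set} {s} → A → NE s → (A × s ≡ N) ⊎ (A × s ≡ E)
  f a N = inj₁ (a , refl)
  f a E = inj₂ (a , refl)

#ES<-split : ∀ {n} (w : Fin n → Step) p →
  # (λ j → (toℕ j ℕ.<? p) ×-dec ES? (w j)) ≡ before w S p + before w E p
#ES<-split w p = #-⊎ (λ j → (toℕ j ℕ.<? p) ×-dec ES? (w j)) (λ j → (toℕ j ℕ.<? p) ×-dec (w j ≟ S)) (λ j → (toℕ j ℕ.<? p) ×-dec (w j ≟ E))
  (λ j (l , x) → f l x) (λ j (l , e) → l , subst ES (sym e) S) (λ j (l , e) → l , subst ES (sym e) E)
  (λ j (_ , e) (_ , e′) → contradiction (trans (sym e) e′) λ ())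
  where
  f : ∀ {A : Set} {s} → A → ES s → (A × s ≡ S) ⊎ (A × s ≡ E)
  f a S = inj₁ (a , refl)
  f a E = inj₂ (a , refl)

X? : ∀ {n} (τ : Permutation′ n) i j → Dec (j < i × τ ⟨$⟩ʳ i < τ ⟨$⟩ʳ j)
X? τ i j = (j <? i) ×-dec (τ ⟨$⟩ʳ i <? τ ⟨$⟩ʳ j)

Y? : ∀ {n} (τ : Permutation′ n) i j → Dec (i < j × τ ⟨$⟩ʳ j < τ ⟨$⟩ʳ i)
Y? τ i j = (i <? j) ×-dec (τ ⟨$⟩ʳ j <? τ ⟨$⟩ʳ i)

module Heights {n} (τ : Permutation′ n) (w : Fin n → Step)
  (up : ∀ i → NE (w i) → i ≤ τ ⟨$⟩ʳ i) (up⁻ : ∀ i → i ≤ τ ⟨$⟩ʳ i → NE (w i))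
  (es : ∀ i → ES (w i) → τ ⟨$⟩ˡ i ≤ i) (es⁻ : ∀ i → τ ⟨$⟩ˡ i ≤ i → ES (w i)) where

  A? = λ p j → (toℕ j ℕ.<? p) ×-dec (p ℕ.≤? toℕ (τ ⟨$⟩ʳ j))
  B? = λ p j → (toℕ (τ ⟨$⟩ʳ j) ℕ.<? p) ×-dec (p ℕ.≤? toℕ j)

  N≡S+A : ∀ p → before w N p ≡ before w S p + # (A? p)
  N≡S+A p = ℕ.+-cancelʳ-≡ (before w E p) _ _ (trans (sym (#NE<-split w p))
    (trans (#-⊎ (λ j → (toℕ j ℕ.<? p) ×-dec NE? (w j)) (λ j → (toℕ (τ ⟨$⟩ʳ j) ℕ.<? p) ×-dec ES? (w (τ ⟨$⟩ʳ j))) (A? p)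
      (λ j (l , x) → f j l x (toℕ (τ ⟨$⟩ʳ j) ℕ.<? p))
      (λ j (l , x) → let m = subst (_≤ τ ⟨$⟩ʳ j) (inverseˡ τ) (es _ x) in ℕ.≤-<-trans m l , up⁻ j m)
      (λ j (l , x) → l , up⁻ j (ℕ.≤-trans (ℕ.<⇒≤ l) x))
      (λ j (l , _) (_ , x) → ℕ.<⇒≱ l x))
    (trans (cong (_+ # (A? p)) (trans (sym (#-permute (λ j → (toℕ j ℕ.<? p) ×-dec ES? (w j)) τ)) (#ES<-split w p)))
      (trans (ℕ.+-assoc (before w S p) _ _) (trans (cong (before w S p +_) (ℕ.+-comm (before w E p) _)) (sym (ℕ.+-assoc (before w S p) _ _)))))))
    where
    f : ∀ j → toℕ j ℕ.< p → NE (w j) → Dec (toℕ (τ ⟨$⟩ʳ j) ℕ.< p) → _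
    f j l x (yes m) = inj₁ (m , es⁻ _ (subst (_≤ τ ⟨$⟩ʳ j) (sym (inverseˡ τ)) (up j x)))
    f j l x (no ¬m) = inj₂ (l , ℕ.≮⇒≥ ¬m)

  A≡B : ∀ p → # (A? p) ≡ # (B? p)
  A≡B p = ℕ.+-cancelˡ-≡ (# C?) _ _ (trans (sym a) (trans (#-permute L? τ) b))
    where
    L? : Decidable (λ j → toℕ j ℕ.< p)
    L? j = toℕ j ℕ.<? p
    C? = λ j → L? j ×-dec L? (τ ⟨$⟩ʳ j)
    f : ∀ {X : Set} j → X → Dec (toℕ j ℕ.< p) → X × toℕ j ℕ.< p ⊎ X × p ℕ.≤ toℕ j
    f j x (yes m) = inj₁ (x , m)
    f j x (no ¬m) = inj₂ (x , ℕ.≮⇒≥ ¬m)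
    g : ∀ {X : Set} j → X → Dec (toℕ j ℕ.< p) → toℕ j ℕ.< p × X ⊎ X × p ℕ.≤ toℕ j
    g j x (yes m) = inj₁ (m , x)
    g j x (no ¬m) = inj₂ (x , ℕ.≮⇒≥ ¬m)
    a : # L? ≡ # C? + # (A? p)
    a = #-⊎ L? C? (A? p) (λ j x → f (τ ⟨$⟩ʳ j) x (L? (τ ⟨$⟩ʳ j))) (λ _ → proj₁) (λ _ → proj₁) (λ j (_ , l) (_ , m) → ℕ.<⇒≱ l m)
    b : # (λ j → L? (τ ⟨$⟩ʳ j)) ≡ # C? + # (B? p)
    b = #-⊎ (λ j → L? (τ ⟨$⟩ʳ j)) C? (B? p) (λ j x → g j x (L? j)) (λ _ → proj₂) (λ _ → proj₁) (λ j (l , _) (_ , m) → ℕ.<⇒≱ l m)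

  height≡A : ∀ p → height w p ≡ # (A? p)
  height≡A p = trans (cong (_∸ before w S p) (N≡S+A p)) (ℕ.m+n∸m≡n (before w S p) _)

  height≡B : ∀ p → height w p ≡ # (B? p)
  height≡B p = trans (height≡A p) (A≡B p)

  history-nonneg : ∀ p → p ℕ.≤ n → before w S p ℕ.≤ before w N p
  history-nonneg p _ = ℕ.≤-trans (ℕ.m≤m+n _ _) (ℕ.≤-reflexive (sym (N≡S+A p)))

  history-closed : before w S n ≡ before w N n
  history-closed = sym (trans (N≡S+A n) (trans (cong (before w S n +_)
    (#-none (A? n) (λ j (_ , l) → ℕ.<⇒≱ (Fin.toℕ<n (τ ⟨$⟩ʳ j)) l))) (ℕ.+-identityʳ _)))

  X≤height : ∀ i → NE (w i) → # (X? τ i) ℕ.≤ height w (toℕ i)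
  X≤height i x = ℕ.≤-trans (#-⊆ (X? τ i) (A? (toℕ i)) (λ j (l , m) → l , ℕ.≤-trans (up i x) (ℕ.<⇒≤ m)))
    (ℕ.≤-reflexive (sym (height≡A (toℕ i))))

  Y<height : ∀ i → SdE (w i) → # (Y? τ i) ℕ.< height w (toℕ i)
  Y<height i x = ℕ.≤-trans (#-⊂ (Y? τ i) (B? (toℕ i)) (λ j (l , m) → ℕ.<-trans m τi<i , ℕ.<⇒≤ l) i (τi<i , ℕ.≤-refl) (λ (l , _) → ℕ.<-irrefl refl l))
    (ℕ.≤-reflexive (sym (height≡B (toℕ i))))
    where τi<i = ℕ.≰⇒> (λ l → SdE⇒¬NE x (up⁻ i l))

cyc : ∀ {k} → Permutation′ (suc k)
cyc {k} = permutation to (λ i → from (view i)) (λ i → l (view i)) r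
  where
  to : Fin (suc k) → Fin (suc k)
  to zero = fromℕ k
  to (suc j) = inject₁ j
  from : {i : Fin (suc k)} → View i → Fin (suc k)
  from ‵fromℕ = zero
  from (‵inject₁ j) = suc j
  l : {i : Fin (suc k)} (v : View i) → to (from v) ≡ i
  l ‵fromℕ = refl
  l (‵inject₁ j) = refl
  r : ∀ i → from (view (to i)) ≡ i
  r zero rewrite view-fromℕ k = refl
  r (suc j) rewrite view-inject₁ j = refl

shift : ∀ {k} → 𝔖 (suc k) → 𝔖 (suc k)
shift π = π ∘ₚ cyc

module Shift {k} (π : 𝔖 (suc k)) where
  τ = shift π
  m = pone π
  πʳ = π ⟨$⟩ʳ_

  π-m : πʳ m ≡ zero
  π-m = inverseʳ π

  is-m : ∀ i → πʳ i ≡ zero → i ≡ m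
  is-m i e = trans (sym (inverseˡ π)) (cong (π ⟨$⟩ˡ_) e)

  top : ∀ i → toℕ i ℕ.≤ k
  top i = ℕ.≤-pred (Fin.toℕ<n i)

  τ-m : toℕ (τ ⟨$⟩ʳ m) ≡ k
  τ-m rewrite π-m = Fin.toℕ-fromℕ k

  τ-¬m : ∀ i → i ≢ m → suc (toℕ (τ ⟨$⟩ʳ i)) ≡ toℕ (πʳ i)
  τ-¬m i ¬e with πʳ i in eq
  ... | zero = contradiction (is-m i eq) ¬e
  ... | suc j = cong suc (Fin.toℕ-inject₁ j)

  up-π : ∀ i → i ≡ m ⊎ i < πʳ i → i ≤ τ ⟨$⟩ʳ i
  up-π i (inj₁ refl) = subst (toℕ m ℕ.≤_) (sym τ-m) (top m)
  up-π i (inj₂ l) = ℕ.≤-pred (subst (toℕ i ℕ.<_)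
    (sym (τ-¬m i (λ { refl → contradiction (subst (i <_) π-m l) λ () }))) l)

  up-π⁻ : ∀ i → i ≤ τ ⟨$⟩ʳ i → i ≡ m ⊎ i < πʳ i
  up-π⁻ i l with i Fin.≟ m
  ... | yes e = inj₁ e
  ... | no ¬e = inj₂ (subst (toℕ i ℕ.<_) (τ-¬m i ¬e) (s≤s l))

  inject₁< : ∀ (a b : Fin k) (c : Fin (suc k)) → ¬ (suc a ≤ c) → c ≤ inject₁ a
  inject₁< a _ c ¬l = subst (toℕ c ℕ.≤_) (sym (Fin.toℕ-inject₁ a)) (ℕ.≤-pred (ℕ.≰⇒> ¬l))

  Shape : (i : Fin (suc k)) → Step → Set
  Shape i s = ((NE s → i ≤ τ ⟨$⟩ʳ i) × (i ≤ τ ⟨$⟩ʳ i → NE s)) × ((ES s → τ ⟨$⟩ˡ i ≤ i) × (τ ⟨$⟩ˡ i ≤ i → ES s))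

  τˡ-inject : ∀ j → τ ⟨$⟩ˡ inject₁ j ≡ π ⟨$⟩ˡ suc j
  τˡ-inject j rewrite view-inject₁ j = refl

  τˡ-top : τ ⟨$⟩ˡ fromℕ k ≡ m
  τˡ-top rewrite view-fromℕ k = refl

  shapeAt : {i : Fin (suc k)} (v : View i) → Shape i (stepAt π v)
  shapeAt ‵fromℕ with m Fin.≟ fromℕ k
  ... | yes e = ((λ _ → up-π _ (inj₁ (sym e))) , λ _ → E) , ((λ _ → Fin.≤fromℕ _) , λ _ → E)
  ... | no ¬e = ((λ ()) , λ l → contradiction (up-π⁻ _ l) λ { (inj₁ e) → ¬e (sym e) ; (inj₂ l) → ℕ.<⇒≱ l (Fin.≤fromℕ _) })
              , ((λ _ → Fin.≤fromℕ _) , λ _ → S)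
  shapeAt (‵inject₁ j) = go (inject₁ j Fin.≟ m) (inject₁ j <? πʳ (inject₁ j)) (suc j ≤? π ⟨$⟩ˡ suc j)
    where
    early : ¬ (suc j ≤ π ⟨$⟩ˡ suc j) → τ ⟨$⟩ˡ inject₁ j ≤ inject₁ j
    early ¬l = subst (_≤ inject₁ j) (sym (τˡ-inject j)) (inject₁< j j _ ¬l)
    late : suc j ≤ π ⟨$⟩ˡ suc j → ¬ (τ ⟨$⟩ˡ inject₁ j ≤ inject₁ j)
    late l x = ℕ.<⇒≱ l (subst₂ ℕ._≤_ (cong toℕ (τˡ-inject j)) (Fin.toℕ-inject₁ j) x)
    down : ¬ (inject₁ j ≡ m) → ¬ (inject₁ j < πʳ (inject₁ j)) → ¬ (inject₁ j ≤ τ ⟨$⟩ʳ inject₁ j)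
    down ¬e ¬a x with up-π⁻ _ x
    ... | inj₁ e = ¬e e
    ... | inj₂ a = ¬a a
    go : (a : Dec (inject₁ j ≡ m)) (b : Dec (inject₁ j < πʳ (inject₁ j))) (c : Dec (suc j ≤ π ⟨$⟩ˡ suc j)) →
         Shape (inject₁ j) (if does a then (if does c then N else E)
           else if does b then (if does c then N else E) else (if does c then dE else S))
    go (yes e) b (yes l) = ((λ _ → up-π _ (inj₁ e)) , λ _ → N) , ((λ ()) , λ x → contradiction x (late l))
    go (yes e) b (no ¬l) = ((λ _ → up-π _ (inj₁ e)) , λ _ → E) , ((λ _ → early ¬l) , λ _ → E)
    go (no ¬e) (yes a) (yes l) = ((λ _ → up-π _ (inj₂ a)) , λ _ → N) , ((λ ()) , λ x → contradiction x (late l))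
    go (no ¬e) (yes a) (no ¬l) = ((λ _ → up-π _ (inj₂ a)) , λ _ → E) , ((λ _ → early ¬l) , λ _ → E)
    go (no ¬e) (no ¬a) (yes l) = ((λ ()) , λ x → contradiction x (down ¬e ¬a)) , ((λ ()) , λ x → contradiction x (late l))
    go (no ¬e) (no ¬a) (no ¬l) = ((λ ()) , λ x → contradiction x (down ¬e ¬a)) , ((λ _ → early ¬l) , λ _ → S)

  shape : ∀ i → Shape i (Φ-step π i)
  shape i = shapeAt (view i)

  open Heights τ (Φ-step π) (λ i → proj₁ (proj₁ (shape i))) (λ i → proj₂ (proj₁ (shape i)))
                   (λ i → proj₁ (proj₂ (shape i))) (λ i → proj₂ (proj₂ (shape i))) public

record Coded {n} (τ : Permutation′ n) (w : Fin n → Step) (c : Fin n → ℕ) : Set where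
  field
    up  : ∀ i → NE (w i) → i ≤ τ ⟨$⟩ʳ i
    up⁻ : ∀ i → i ≤ τ ⟨$⟩ʳ i → NE (w i)
    es  : ∀ i → ES (w i) → τ ⟨$⟩ˡ i ≤ i
    es⁻ : ∀ i → τ ⟨$⟩ˡ i ≤ i → ES (w i)
    hi  : ∀ i → NE (w i) → c i ≡ # (X? τ i)
    lo  : ∀ i → SdE (w i) → c i ≡ suc (# (Y? τ i))
  down : ∀ i → SdE (w i) → τ ⟨$⟩ʳ i < i
  down i x = ℕ.≰⇒> (λ l → SdE⇒¬NE x (up⁻ i l))
  open Heights τ w up up⁻ es es⁻ public

  history : 𝔏 n
  history = record
    { step = w ; nonneg = history-nonneg ; closed = history-closed ; label = c
    ; label-NE = λ i x → subst (ℕ._≤ _) (sym (hi i x)) (X≤height i x)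
    ; label-SdE = λ i x → subst (1 ℕ.≤_) (sym (lo i x)) (s≤s z≤n) , subst (ℕ._≤ _) (sym (lo i x)) (Y<height i x) }

if-yes : {A B : Set} {x y : B} (d : Dec A) → A → (if does d then x else y) ≡ x
if-yes (yes _) a = refl
if-yes (no ¬a) a = contradiction a ¬a

if-no : {A B : Set} {x y : B} (d : Dec A) → ¬ A → (if does d then x else y) ≡ y
if-no (yes a) ¬a = contradiction a ¬a
if-no (no _) ¬a = refl

module Labels {k} (π : 𝔖 (suc k)) where
  open Shift π

  nest? = λ i j → ((j <? i) ×-dec ((i <? πʳ i) ×-dec (πʳ i <? πʳ j)))
          ⊎-dec  ((πʳ j <? πʳ i) ×-dec ((πʳ i ≤? i) ×-dec (i <? j)))
  dec? = λ i → (πʳ i ≤? i) ×-dec (i <? m)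
  inc? = λ i → (i <? πʳ i) ×-dec (m <? i)

  none : ∀ (j : Fin (suc k)) → ¬ (j < πʳ m)
  none j l = contradiction (subst (j <_) π-m l) λ ()

  τ< : ∀ i j → i ≢ m → j ≢ m → πʳ i < πʳ j → τ ⟨$⟩ʳ i < τ ⟨$⟩ʳ j
  τ< i j a b l = ℕ.≤-pred (subst₂ ℕ._<_ (sym (τ-¬m i a)) (sym (τ-¬m j b)) l)

  τ<⁻ : ∀ i j → i ≢ m → j ≢ m → τ ⟨$⟩ʳ i < τ ⟨$⟩ʳ j → πʳ i < πʳ j
  τ<⁻ i j a b l = subst₂ ℕ._<_ (τ-¬m i a) (τ-¬m j b) (s≤s l)

  τ≤k : ∀ j → ¬ (τ ⟨$⟩ʳ m < τ ⟨$⟩ʳ j)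
  τ≤k j l = ℕ.<⇒≱ (subst (ℕ._< toℕ (τ ⟨$⟩ʳ j)) τ-m l) (top (τ ⟨$⟩ʳ j))

  τ<k : ∀ i → i ≢ m → τ ⟨$⟩ʳ i < τ ⟨$⟩ʳ m
  τ<k i a = subst₂ ℕ._≤_ (sym (τ-¬m i a)) (sym τ-m) (top (πʳ i))

  exceeds : ∀ {i j} → j < πʳ i → i ≢ m
  exceeds {j = j} l refl = none j l

  hi-m : vnest π m ≡ # (X? τ m)
  hi-m = trans (if-no (dec? m) (λ (_ , l) → ℕ.<-irrefl refl l))
    (trans (if-no (inc? m) (λ (l , _) → none m l))
    (trans (#-none (nest? m) λ { j (inj₁ (_ , l , _)) → none m l ; j (inj₂ (l , _)) → none (πʳ j) l })
    (sym (#-none (X? τ m) (λ j (_ , l) → τ≤k j l)))))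

  hi-exc : ∀ i → i < πʳ i → vnest π i ≡ # (X? τ i)
  hi-exc i i<πi = trans (if-no (dec? i) (λ (l , _) → ℕ.<⇒≱ i<πi l)) (go (m <? i))
    where
    i≢m = exceeds i<πi
    fwd : ∀ j → j ≢ m → j < i × τ ⟨$⟩ʳ i < τ ⟨$⟩ʳ j → _
    fwd j b (l , p) = inj₁ (l , i<πi , τ<⁻ i j i≢m b p)
    bwd : ∀ j → _ → j < i × τ ⟨$⟩ʳ i < τ ⟨$⟩ʳ j
    bwd j (inj₁ (l , _ , p)) = l , τ< i j i≢m (exceeds p) p
    bwd j (inj₂ (_ , l , _)) = contradiction l (ℕ.<⇒≱ i<πi)
    go : Dec (m < i) → _
    go (yes a) = trans (if-yes (inc? i) (i<πi , a)) (sym (trans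
      (#-⊎ (X? τ i) (nest? i) (Fin._≟ m) (λ j x → f j x (j Fin.≟ m)) bwd (λ { _ refl → a , τ<k i i≢m }) λ j x e → d j e x)
      (cong (nest π i +_) (#-one (Fin._≟ m) m refl (λ _ e → e)))))
      where
      f : ∀ j → _ → Dec (j ≡ m) → _
      f j x (yes e) = inj₂ e
      f j x (no b) = inj₁ (fwd j b x)
      d : ∀ j → j ≡ m → _ → ⊥
      d j refl (inj₁ (_ , _ , l)) = none (πʳ i) l
      d j refl (inj₂ (_ , l , _)) = contradiction l (ℕ.<⇒≱ i<πi)
    go (no ¬a) = trans (if-no (inc? i) (¬a ∘ proj₂)) (#-cong (nest? i) (X? τ i) bwd
      (λ j x → fwd j (λ { refl → ¬a (proj₁ x) }) x))

  lo-nex : ∀ i → πʳ i ≤ i → i ≢ m → vnest π i ≡ # (Y? τ i)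
  lo-nex i πi≤i i≢m = go (i <? m)
    where
    fwd : ∀ j → j ≢ m → i < j × τ ⟨$⟩ʳ j < τ ⟨$⟩ʳ i → _
    fwd j b (l , p) = inj₂ (τ<⁻ j i b i≢m p , πi≤i , l)
    bwd : ∀ j → j ≢ m → _ → i < j × τ ⟨$⟩ʳ j < τ ⟨$⟩ʳ i
    bwd j b (inj₁ (_ , l , _)) = contradiction πi≤i (ℕ.<⇒≱ l)
    bwd j b (inj₂ (p , _ , l)) = l , τ< j i b i≢m p
    Y≢m : ∀ {j} → i < j × τ ⟨$⟩ʳ j < τ ⟨$⟩ʳ i → j ≢ m
    Y≢m (_ , l) refl = τ≤k i l
    πi>0 : πʳ m < πʳ i
    πi>0 = subst₂ ℕ._<_ (cong toℕ (sym π-m)) (τ-¬m i i≢m) (s≤s z≤n)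
    go : Dec (i < m) → _
    go (yes a) = trans (if-yes (dec? i) (πi≤i , a)) (trans (cong (_∸ 1) (trans
      (#-⊎ (nest? i) (Y? τ i) (Fin._≟ m) (λ j x → f j x (j Fin.≟ m)) (λ j y → fwd j (Y≢m y) y)
         (λ { _ refl → inj₂ (πi>0 , πi≤i , a) }) (λ j y e → Y≢m y e))
      (cong (# (Y? τ i) +_) (#-one (Fin._≟ m) m refl (λ _ e → e))))) (ℕ.m+n∸n≡m (# (Y? τ i)) 1))
      where
      f : ∀ j → _ → Dec (j ≡ m) → _
      f j x (yes e) = inj₂ e
      f j x (no b) = inj₁ (bwd j b x)
    go (no ¬a) = trans (if-no (dec? i) (¬a ∘ proj₂)) (trans (if-no (inc? i) (λ (l , _) → ℕ.<⇒≱ l πi≤i))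
      (#-cong (nest? i) (Y? τ i) (λ j x → bwd j (λ e → g j e x) x) (λ j y → fwd j (Y≢m y) y)))
      where
      g : ∀ j → j ≡ m → _ → ⊥
      g j refl (inj₁ (_ , l , _)) = contradiction πi≤i (ℕ.<⇒≱ l)
      g j refl (inj₂ (_ , _ , l)) = ¬a l

  hi-vnest : ∀ i → i ≤ τ ⟨$⟩ʳ i → vnest π i ≡ # (X? τ i)
  hi-vnest i x = go (up-π⁻ i x)
    where
    go : i ≡ m ⊎ i < πʳ i → vnest π i ≡ # (X? τ i)
    go (inj₁ refl) = hi-m
    go (inj₂ l) = hi-exc i l

  lo-vnest : ∀ i → ¬ (i ≤ τ ⟨$⟩ʳ i) → vnest π i ≡ # (Y? τ i)
  lo-vnest i x = lo-nex i (ℕ.≮⇒≥ (λ l → x (up-π i (inj₂ l)))) (λ e → x (up-π i (inj₁ e)))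

  Φ-coded : Coded τ (Φ-step π) (Φ-label π)
  Φ-coded = record
    { up = λ i → proj₁ (proj₁ (shape i)) ; up⁻ = λ i → proj₂ (proj₁ (shape i))
    ; es = λ i → proj₁ (proj₂ (shape i)) ; es⁻ = λ i → proj₂ (proj₂ (shape i))
    ; hi = λ i x → trans (cong₂ _+_ (hi-vnest i (proj₁ (proj₁ (shape i)) x)) (χ-no (SdE? (Φ-step π i)) (λ y → SdE⇒¬NE y x))) (ℕ.+-identityʳ _)
    ; lo = λ i x → trans (cong₂ _+_ (lo-vnest i (λ l → SdE⇒¬NE x (proj₂ (proj₁ (shape i)) l))) (χ-yes (SdE? (Φ-step π i)) x)) (ℕ.+-comm _ 1)
    }

Φ : ∀ {k} → 𝔖 (suc k) → 𝔏 (suc k)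
Φ π = Coded.history (Labels.Φ-coded π)

opp-opp : ∀ {n} (i : Fin n) → opposite (opposite i) ≡ i
opp-opp = Fin.opposite-involutive

opp-injective : ∀ {n} {i j : Fin n} → opposite i ≡ opposite j → i ≡ j
opp-injective {i = i} {j} e = trans (sym (opp-opp i)) (trans (cong opposite e) (opp-opp j))

opp-< : ∀ {n} {i j : Fin n} → i < j → opposite j < opposite i
opp-< {n} {i} {j} l = subst₂ ℕ._<_ (sym (Fin.opposite-prop j)) (sym (Fin.opposite-prop i))
  (ℕ.∸-monoʳ-< (s≤s l) (Fin.toℕ<n j))

opp-≤ : ∀ {n} {i j : Fin n} → i ≤ j → opposite j ≤ opposite i
opp-≤ {n} {i} {j} l = subst₂ ℕ._≤_ (sym (Fin.opposite-prop j)) (sym (Fin.opposite-prop i))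
  (ℕ.∸-monoʳ-≤ n (s≤s l))

mirror : ∀ {n} → Permutation′ n → Permutation′ n
mirror τ = reverse ∘ₚ (τ ∘ₚ reverse)

X-mirror : ∀ {n} (τ : Permutation′ n) i → # (X? τ (opposite i)) ≡ # (Y? (mirror τ) i)
X-mirror τ i = trans (#-permute (X? τ (opposite i)) reverse)
  (#-cong (λ j → X? τ (opposite i) (opposite j)) (Y? (mirror τ) i)
    (λ j (l , m) → subst₂ _<_ (opp-opp i) (opp-opp j) (opp-< l) , opp-< m)
    (λ j (l , m) → opp-< l , subst₂ _<_ (opp-opp _) (opp-opp _) (opp-< m)))

module Dir {n} {τ : Permutation′ n} {w c} (T : Coded τ w c) where
  open Coded T

  UV : ∀ i → SdE (w i) → ¬ ES (w (τ ⟨$⟩ʳ i))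
  UV i x y = ℕ.<⇒≱ (down i x) (subst (_≤ τ ⟨$⟩ʳ i) (inverseˡ τ) (es _ y))

  VU : ∀ v → ¬ ES (w v) → SdE (w (τ ⟨$⟩ˡ v))
  VU v x = ¬NE⇒SdE (λ y → x (es⁻ v (subst (τ ⟨$⟩ˡ v ≤_) (inverseʳ τ) (up _ y))))

  UV′ : ∀ i → NE (w (opposite i)) → ES (w (opposite (mirror τ ⟨$⟩ʳ i)))
  UV′ i x = subst (ES ∘ w) (sym (opp-opp _)) (es⁻ _ (subst (_≤ τ ⟨$⟩ʳ opposite i) (sym (inverseˡ τ)) (up _ x)))

  VU′ : ∀ v → ES (w (opposite v)) → NE (w (opposite (mirror τ ⟨$⟩ˡ v)))
  VU′ v x = subst (NE ∘ w) (sym (opp-opp _)) (up⁻ _ (subst (τ ⟨$⟩ˡ opposite v ≤_) (sym (inverseʳ τ)) (es _ x)))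

  lo′ : ∀ i → SdE (w i) → suc (# (λ j → SdE? (w j) ×-dec Y? τ i j)) ≡ c i
  lo′ i x = trans (cong suc (#-cong (λ j → SdE? (w j) ×-dec Y? τ i j) (Y? τ i) (λ _ → proj₂)
      (λ j (l , m) → ¬NE⇒SdE (λ y → ℕ.<⇒≱ (ℕ.<-trans m (ℕ.<-trans (down i x) l)) (up j y)) , l , m)))
    (sym (lo i x))

  hi′ : ∀ i → NE (w (opposite i)) → # (λ j → NE? (w (opposite j)) ×-dec Y? (mirror τ) i j) ≡ c (opposite i)
  hi′ i x = trans (#-cong (λ j → NE? (w (opposite j)) ×-dec Y? (mirror τ) i j) (Y? (mirror τ) i) (λ _ → proj₂)
      (λ j (l , m) → up⁻ _ (ℕ.<⇒≤ (ℕ.<-trans (opp-< l) (ℕ.≤-<-trans (up _ x)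
        (subst₂ _<_ (opp-opp _) (opp-opp _) (opp-< m))))) , l , m))
    (trans (sym (X-mirror τ i)) (sym (hi _ x)))

Coded-unique : ∀ {n} {τ σ : Permutation′ n} {w c} → Coded τ w c → Coded σ w c → τ ≈ σ
Coded-unique {n} {τ} {σ} {w} T T′ i = go (NE? (w i))
  where
  module T = Dir T
  module T′ = Dir T′
  go : Dec (NE (w i)) → τ ⟨$⟩ʳ i ≡ σ ⟨$⟩ʳ i
  go (no ¬x) = agree {U = SdE ∘ w} {V = ¬_ ∘ ES ∘ w} (λ j → SdE? (w j)) τ σ T.UV T.VU T′.UV T′.VU
    (λ j y → ℕ.suc-injective (trans (T.lo′ j y) (sym (T′.lo′ j y)))) i (¬NE⇒SdE ¬x)
  go (yes x) = subst (λ i → τ ⟨$⟩ʳ i ≡ σ ⟨$⟩ʳ i) (opp-opp i) (opp-injective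
    (agree {U = NE ∘ w ∘ opposite} {V = ES ∘ w ∘ opposite} (λ j → NE? (w (opposite j))) (mirror τ) (mirror σ)
      T.UV′ T.VU′ T′.UV′ T′.VU′ (λ j y → trans (T.hi′ j y) (sym (T′.hi′ j y)))
      (opposite i) (subst (NE ∘ w) (sym (opp-opp i)) x)))

extract : ∀ {n} {U V : Fin n → Set} (U? : Decidable U) (V? : Decidable V) (μ : Permutation′ n) (f : Fin n → Fin n) →
  (∀ i → U i → μ ⟨$⟩ʳ i ≡ f i) → (∀ i → U i → V (μ ⟨$⟩ʳ i)) → (∀ i → V (μ ⟨$⟩ʳ i) → U i) → ∀ i → U i → ∀ {c} →
  c + # (λ j → (U? j ×-dec (j <? i)) ×-dec (f j <? f i)) ≡ # (λ v → V? v ×-dec (v <? f i)) →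
  c ≡ # (λ j → U? j ×-dec Y? μ i j)
extract U? V? μ f μ≡f UV VU i u e = ℕ.+-cancelʳ-≡ (# L?) _ _ (trans e (trans
  (#-permute (λ v → V? v ×-dec (v <? f i)) μ)
  (#-⊎ (λ j → V? (μ ⟨$⟩ʳ j) ×-dec (μ ⟨$⟩ʳ j <? f i)) R? L?
    (λ j (x , l) → split j (VU j x) l)
    (λ j (x , _ , m) → UV j x , subst (μ ⟨$⟩ʳ j <_) (μ≡f i u) m)
    (λ j ((x , _) , m) → UV j x , subst (_< f i) (sym (μ≡f j x)) m)
    (λ j (_ , l , _) ((_ , m) , _) → ℕ.<-asym l m))))
  where
  L? = λ j → (U? j ×-dec (j <? i)) ×-dec (f j <? f i)
  R? = λ j → U? j ×-dec Y? μ i j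
  split : ∀ j → _ → μ ⟨$⟩ʳ j < f i → _
  split j x l with Fin.<-cmp i j
  ... | tri< m _ _ = inj₁ (x , m , subst (μ ⟨$⟩ʳ j <_) (sym (μ≡f i u)) l)
  ... | tri≈ _ refl _ = contradiction l (ℕ.<-irrefl (cong toℕ (μ≡f i u)))
  ... | tri> _ _ m = inj₂ ((x , m) , subst (_< f i) (μ≡f j x) l)

module Decode {n} (W : 𝔏 n) where
  w = step W
  c = label W

  below? : ∀ p → Decidable (λ (j : Fin n) → toℕ j ℕ.< p)
  below? p j = toℕ j ℕ.<? p

  N≡S+h : ∀ p → p ℕ.≤ n → before w N p ≡ before w S p + height w p
  N≡S+h p l = sym (ℕ.m+[n∸m]≡n (nonneg W p l))

  bound↓ : ∀ i → SdE (w i) → (c i ∸ 1) + # (λ j → SdE? (w j) ×-dec (j <? i)) ℕ.< # (λ v → ¬? (ES? (w v)) ×-dec (v <? i))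
  bound↓ i x = subst (c i ∸ 1 + d ℕ.<_) key (ℕ.+-monoˡ-< d (ℕ.≤-trans (ℕ.≤-reflexive (ℕ.m+[n∸m]≡n (proj₁ (label-SdE W i x)))) (proj₂ (label-SdE W i x))))
    where
    p = toℕ i
    d = # (λ j → SdE? (w j) ×-dec (j <? i))
    e = # (λ v → ¬? (ES? (w v)) ×-dec (v <? i))
    split₁ : # (below? p) ≡ (before w N p + before w E p) + d
    split₁ = trans (#-⊎ (below? p) (λ j → below? p j ×-dec NE? (w j)) (λ j → SdE? (w j) ×-dec (j <? i))
      (λ j l → f j l (NE? (w j))) (λ _ → proj₁) (λ _ → proj₂) (λ _ (_ , a) (b , _) → SdE⇒¬NE b a))
      (cong (_+ d) (#NE<-split w p))
      where
      f : ∀ j → j < i → Dec (NE (w j)) → _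
      f j l (yes a) = inj₁ (l , a)
      f j l (no ¬a) = inj₂ (¬NE⇒SdE ¬a , l)
    split₂ : # (below? p) ≡ (before w S p + before w E p) + e
    split₂ = trans (#-⊎ (below? p) (λ j → below? p j ×-dec ES? (w j)) (λ v → ¬? (ES? (w v)) ×-dec (v <? i))
      (λ j l → f j l (ES? (w j))) (λ _ → proj₁) (λ _ → proj₂) (λ _ (_ , a) (b , _) → b a))
      (cong (_+ e) (#ES<-split w p))
      where
      f : ∀ j → j < i → Dec (ES (w j)) → _
      f j l (yes a) = inj₁ (l , a)
      f j l (no ¬a) = inj₂ (¬a , l)
    arith : ∀ s h ee d → s + ee + (h + d) ≡ s + h + ee + d
    arith = solve-∀
    key : height w p + d ≡ e
    key = ℕ.+-cancelˡ-≡ (before w S p + before w E p) _ _ (trans (arith (before w S p) (height w p) (before w E p) d)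
      (trans (cong (λ z → z + before w E p + d) (sym (N≡S+h p (ℕ.<⇒≤ (Fin.toℕ<n i))))) (trans (sym split₁) split₂)))

  bound↑ : ∀ i → NE (w i) → c i + # (λ j → NE? (w j) ×-dec (i <? j)) ℕ.< # (λ v → ES? (w v) ×-dec (i ≤? v))
  bound↑ i x = subst (c i + d ℕ.<_) key (s≤s (ℕ.+-monoˡ-≤ d (label-NE W i x)))
    where
    p = toℕ i
    d = # (λ j → NE? (w j) ×-dec (i <? j))
    e = # (λ v → ES? (w v) ×-dec (i ≤? v))
    NE≤? = λ j → NE? (w j) ×-dec (i ≤? j)
    split₀ : # NE≤? ≡ 1 + d
    split₀ = trans (#-⊎ NE≤? (Fin._≟ i) (λ j → NE? (w j) ×-dec (i <? j))
      (λ j (a , l) → f j a (ℕ.m≤n⇒m<n∨m≡n l)) (λ { _ refl → x , ℕ.≤-refl }) (λ j (a , l) → a , ℕ.<⇒≤ l)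
      (λ { _ refl (_ , l) → ℕ.<-irrefl refl l }))
      (cong (_+ d) (#-one (Fin._≟ i) i refl (λ _ e → e)))
      where
      f : ∀ j → NE (w j) → i < j ⊎ toℕ i ≡ toℕ j → _
      f j a (inj₁ l) = inj₂ (a , l)
      f j a (inj₂ e) = inj₁ (sym (Fin.toℕ-injective e))
    total : ∀ {P : Step → Set} (P? : Decidable P) →
      # (λ j → below? n j ×-dec P? (w j)) ≡ # (λ j → below? p j ×-dec P? (w j)) + # (λ j → P? (w j) ×-dec (i ≤? j))
    total {P} P? = #-⊎ (λ j → below? n j ×-dec P? (w j)) (λ j → below? p j ×-dec P? (w j)) (λ j → P? (w j) ×-dec (i ≤? j))
      (λ j (_ , a) → f j a (below? p j)) (λ j (_ , a) → Fin.toℕ<n j , a) (λ j (a , _) → Fin.toℕ<n j , a)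
      (λ j (l , _) (_ , m) → ℕ.<⇒≱ l m)
      where
      f : ∀ j → P (w j) → Dec (j < i) → _
      f j a (yes l) = inj₁ (l , a)
      f j a (no ¬l) = inj₂ (a , ℕ.≮⇒≥ ¬l)
    arith : ∀ s h ee d → s + ee + suc (h + d) ≡ s + h + ee + (1 + d)
    arith = solve-∀
    key : suc (height w p + d) ≡ e
    key = ℕ.+-cancelˡ-≡ (before w S p + before w E p) _ _ (trans (arith (before w S p) (height w p) (before w E p) d)
      (trans (cong (λ z → z + before w E p + (1 + d)) (sym (N≡S+h p (ℕ.<⇒≤ (Fin.toℕ<n i)))))
      (trans (cong₂ _+_ (sym (#NE<-split w p)) (sym split₀))
      (trans (sym (total NE?)) (trans (#NE<-split w n) (trans (cong (_+ before w E n) (sym (closed W)))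
      (trans (sym (#ES<-split w n)) (trans (total ES?) (cong (_+ e) (#ES<-split w p))))))))))

  U↓? = λ j → SdE? (w j)
  V↓? = λ j → ¬? (ES? (w j))
  U↑? = λ j → NE? (w (opposite j))
  V↑? = λ j → ES? (w (opposite j))

  match↓ = matching U↓? V↓? (λ i v → v <? i) (λ l m → ℕ.<-trans m l) (λ l m → ℕ.<-trans l m) (λ i → c i ∸ 1) bound↓
  match↑ = matching U↑? V↑? (λ i v → v ≤? i) (λ l m → ℕ.≤-trans m (ℕ.<⇒≤ l)) (λ l m → ℕ.≤-trans (ℕ.<⇒≤ l) m) (c ∘ opposite)
    (λ i x → subst₂ (λ a b → c (opposite i) + a ℕ.< b)
      (trans (#-permute (λ j → NE? (w j) ×-dec (opposite i <? j)) reverse)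
        (#-cong (λ j → NE? (w (opposite j)) ×-dec (opposite i <? opposite j)) (λ j → U↑? j ×-dec (j <? i))
          (λ j (a , l) → a , subst₂ _<_ (opp-opp j) (opp-opp i) (opp-< l)) (λ j (a , l) → a , opp-< l)))
      (trans (#-permute (λ j → ES? (w j) ×-dec (opposite i ≤? j)) reverse)
        (#-cong (λ j → ES? (w (opposite j)) ×-dec (opposite i ≤? opposite j)) (λ j → V↑? j ×-dec (j ≤? i))
          (λ j (a , l) → a , subst₂ _≤_ (opp-opp j) (opp-opp i) (opp-≤ l)) (λ j (a , l) → a , opp-≤ l)))
      (bound↑ (opposite i) x))

  f↓ = proj₁ match↓
  f↑ = proj₁ match↑

  pick : {s : Step} → Dec (NE s) → Fin n → Fin n
  pick d i = if does d then opposite (f↑ (opposite i)) else f↓ i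

  f : Fin n → Fin n
  f i = pick (NE? (w i)) i

  f-NE : ∀ i → NE (w i) → f i ≡ opposite (f↑ (opposite i))
  f-NE i x = if-yes (NE? (w i)) x

  f-SdE : ∀ i → SdE (w i) → f i ≡ f↓ i
  f-SdE i x = if-no (NE? (w i)) (SdE⇒¬NE x)

  NE-opp : ∀ {i} → NE (w i) → NE (w (opposite (opposite i)))
  NE-opp {i} = subst (NE ∘ w) (sym (opp-opp i))

  F↑ : ∀ i → NE (w i) → ES (w (f i)) × i ≤ f i
  F↑ i x = let a , l = proj₁ (proj₂ match↑) (opposite i) (NE-opp x) in
    subst (λ z → ES (w z) × i ≤ z) (sym (f-NE i x)) (a , subst (_≤ opposite (f↑ (opposite i))) (opp-opp i) (opp-≤ l))

  F↓ : ∀ i → SdE (w i) → ¬ ES (w (f i)) × f i < i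
  F↓ i x = subst (λ z → ¬ ES (w z) × z < i) (sym (f-SdE i x)) (proj₁ (proj₂ match↓) i x)

  f-inj : ∀ i j → f i ≡ f j → i ≡ j
  f-inj i j e = go (NE? (w i)) (NE? (w j))
    where
    go : Dec (NE (w i)) → Dec (NE (w j)) → i ≡ j
    go (yes x) (yes y) = opp-injective (proj₁ (proj₂ (proj₂ match↑)) (opposite i) (opposite j) (NE-opp x) (NE-opp y)
      (opp-injective (trans (sym (f-NE i x)) (trans e (f-NE j y)))))
    go (yes x) (no y) = contradiction (subst (ES ∘ w) e (proj₁ (F↑ i x))) (proj₁ (F↓ j (¬NE⇒SdE y)))
    go (no x) (yes y) = contradiction (subst (ES ∘ w) (sym e) (proj₁ (F↑ j y))) (proj₁ (F↓ i (¬NE⇒SdE x)))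
    go (no x) (no y) = proj₁ (proj₂ (proj₂ match↓)) i j (¬NE⇒SdE x) (¬NE⇒SdE y)
      (trans (sym (f-SdE i (¬NE⇒SdE x))) (trans e (f-SdE j (¬NE⇒SdE y))))

  τ : Permutation′ n
  τ = proj₁ (injective⇒permutation f f-inj)

  up : ∀ i → NE (w i) → i ≤ τ ⟨$⟩ʳ i
  up i x = proj₂ (F↑ i x)

  up⁻ : ∀ i → i ≤ τ ⟨$⟩ʳ i → NE (w i)
  up⁻ i l = go (NE? (w i))
    where
    go : Dec (NE (w i)) → NE (w i)
    go (yes x) = x
    go (no x) = contradiction l (ℕ.<⇒≱ (proj₂ (F↓ i (¬NE⇒SdE x))))

  esʳ : ∀ j → ES (w (τ ⟨$⟩ʳ j)) → NE (w j)
  esʳ j y = go (NE? (w j))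
    where
    go : Dec (NE (w j)) → NE (w j)
    go (yes x) = x
    go (no x) = contradiction y (proj₁ (F↓ j (¬NE⇒SdE x)))

  es : ∀ i → ES (w i) → τ ⟨$⟩ˡ i ≤ i
  es i y = subst (τ ⟨$⟩ˡ i ≤_) (inverseʳ τ) (up _ (esʳ _ (subst (ES ∘ w) (sym (inverseʳ τ)) y)))

  es⁻ : ∀ i → τ ⟨$⟩ˡ i ≤ i → ES (w i)
  es⁻ i l = subst (ES ∘ w) (inverseʳ τ) (proj₁ (F↑ (τ ⟨$⟩ˡ i) (up⁻ _ (subst (τ ⟨$⟩ˡ i ≤_) (sym (inverseʳ τ)) l))))

  lo : ∀ i → SdE (w i) → c i ≡ suc (# (Y? τ i))
  lo i x = trans (sym (ℕ.m+[n∸m]≡n (proj₁ (label-SdE W i x)))) (cong suc (trans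
    (extract U↓? V↓? τ f↓ f-SdE (λ j y → proj₁ (F↓ j y)) (λ j y → ¬NE⇒SdE (λ z → y (proj₁ (F↑ j z)))) i x
      (proj₂ (proj₂ (proj₂ match↓)) i x))
    (#-cong (λ j → U↓? j ×-dec Y? τ i j) (Y? τ i) (λ _ → proj₂)
      (λ j (l , m) → ¬NE⇒SdE (λ y → ℕ.<⇒≱ (ℕ.<-trans m (ℕ.<-trans (proj₂ (F↓ i x)) l)) (up j y)) , l , m))))

  hi-opp : ∀ i → NE (w (opposite i)) → c (opposite i) ≡ # (X? τ (opposite i))
  hi-opp i x = trans
    (extract U↑? V↑? (mirror τ) f↑
      (λ j y → trans (cong opposite (f-NE (opposite j) y)) (trans (opp-opp _) (cong f↑ (opp-opp j))))
      (λ j y → subst (ES ∘ w) (sym (opp-opp _)) (proj₁ (F↑ _ y)))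
      (λ j y → esʳ _ (subst (ES ∘ w) (opp-opp _) y)) i x
      (proj₂ (proj₂ (proj₂ match↑)) i x))
    (trans (#-cong (λ j → U↑? j ×-dec Y? (mirror τ) i j) (Y? (mirror τ) i) (λ _ → proj₂)
      (λ j (l , m) → up⁻ _ (ℕ.<⇒≤ (ℕ.<-trans (opp-< l) (ℕ.≤-<-trans (up _ x)
        (subst₂ _<_ (opp-opp _) (opp-opp _) (opp-< m))))) , l , m))
     (sym (X-mirror τ i)))

  coded : Coded τ w c
  coded = record { up = up ; up⁻ = up⁻ ; es = es ; es⁻ = es⁻ ; lo = lo
    ; hi = λ i x → subst (λ i → c i ≡ # (X? τ i)) (opp-opp i) (hi-opp (opposite i) (NE-opp x)) }

≈-from : ∀ {n} {τ σ : Permutation′ n} → τ ≈ σ → ∀ v → τ ⟨$⟩ˡ v ≡ σ ⟨$⟩ˡ v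
≈-from {τ = τ} {σ} e v = trans (cong (τ ⟨$⟩ˡ_) (sym (trans (e _) (inverseʳ σ)))) (inverseˡ τ)

Coded-respects : ∀ {n} {τ σ : Permutation′ n} {w w′ c c′} → τ ≈ σ → (∀ i → w i ≡ w′ i) → (∀ i → c i ≡ c′ i) →
                 Coded τ w c → Coded σ w′ c′
Coded-respects {τ = τ} {σ} p q r T = record
  { up = λ i x → subst (i ≤_) (p i) (up i (subst NE (sym (q i)) x))
  ; up⁻ = λ i x → subst NE (q i) (up⁻ i (subst (i ≤_) (sym (p i)) x))
  ; es = λ i x → subst (_≤ i) (≈-from {τ = τ} {σ} p i) (es i (subst ES (sym (q i)) x))
  ; es⁻ = λ i x → subst ES (q i) (es⁻ i (subst (_≤ i) (sym (≈-from {τ = τ} {σ} p i)) x))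
  ; hi = λ i x → trans (sym (r i)) (trans (hi i (subst NE (sym (q i)) x)) (#-cong (X? τ i) (X? σ i)
      (λ j (l , m) → l , subst₂ _<_ (p i) (p j) m) (λ j (l , m) → l , subst₂ _<_ (sym (p i)) (sym (p j)) m)))
  ; lo = λ i x → trans (sym (r i)) (trans (lo i (subst SdE (sym (q i)) x)) (cong suc (#-cong (Y? τ i) (Y? σ i)
      (λ j (l , m) → l , subst₂ _<_ (p j) (p i) m) (λ j (l , m) → l , subst₂ _<_ (sym (p j)) (sym (p i)) m))))
  }
  where open Coded T

Coded-functional : ∀ {n} {τ : Permutation′ n} {w w′ c c′} → Coded τ w c → Coded τ w′ c′ →
                   (∀ i → w i ≡ w′ i) × (∀ i → c i ≡ c′ i)
Coded-functional {w = w} {w′} {c} {c′} T T′ = step≡ , λ i → go i (NE? (w i))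
  where
  module T = Coded T
  module T′ = Coded T′
  step≡ : ∀ i → w i ≡ w′ i
  step≡ i = step-unique (λ x → T′.up⁻ i (T.up i x)) (λ x → T.up⁻ i (T′.up i x)) (λ x → T′.es⁻ i (T.es i x)) (λ x → T.es⁻ i (T′.es i x))
  go : ∀ i → Dec (NE (w i)) → c i ≡ c′ i
  go i (yes x) = trans (T.hi i x) (sym (T′.hi i (subst NE (step≡ i) x)))
  go i (no x) = trans (T.lo i (¬NE⇒SdE x)) (sym (T′.lo i (subst SdE (step≡ i) (¬NE⇒SdE x))))

Φ⁻¹ : ∀ {k} → 𝔏 (suc k) → 𝔖 (suc k)
Φ⁻¹ W = Decode.τ W ∘ₚ flip cyc

Φ-coded = Labels.Φ-coded

Φ⁻¹-coded : ∀ {k} (W : 𝔏 (suc k)) → Coded (shift (Φ⁻¹ W)) (step W) (label W)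
Φ⁻¹-coded {k} W = Coded-respects {σ = shift (Φ⁻¹ W)} (λ i → sym (inverseʳ (cyc {k}))) (λ _ → refl) (λ _ → refl) (Decode.coded W)

Φ∘Φ⁻¹ : ∀ {k} (W : 𝔏 (suc k)) → Φ (Φ⁻¹ W) ≋ W
Φ∘Φ⁻¹ W = Coded-functional (Φ-coded (Φ⁻¹ W)) (Φ⁻¹-coded W)

Φ-injective : ∀ {k} (π σ : 𝔖 (suc k)) → Φ π ≋ Φ σ → π ≈ σ
Φ-injective {k} π σ (p , q) i = trans (sym (inverseˡ (cyc {k}))) (trans (cong (cyc {k} ⟨$⟩ˡ_) (e i)) (inverseˡ (cyc {k})))
  where
  e : shift π ≈ shift σ
  e = Coded-unique (Coded-respects {σ = shift π} (λ _ → refl) p q (Φ-coded π)) (Φ-coded σ)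

Φ-cong : ∀ {k} (π σ : 𝔖 (suc k)) → π ≈ σ → Φ π ≋ Φ σ
Φ-cong {k} π σ e = Coded-functional (Coded-respects {σ = shift σ} (λ i → cong (cyc {k} ⟨$⟩ʳ_) (e i)) (λ _ → refl) (λ _ → refl) (Φ-coded π)) (Φ-coded σ)

Φ⁻¹∘Φ : ∀ {k} (π : 𝔖 (suc k)) → Φ⁻¹ (Φ π) ≈ π
Φ⁻¹∘Φ π = Φ-injective (Φ⁻¹ (Φ π)) π (Φ∘Φ⁻¹ (Φ π))

ρ : ∀ {k} → (𝔏 (suc k) → 𝔏 (suc k)) → 𝔖 (suc k) → 𝔖 (suc k)
ρ ξ = Φ⁻¹ ∘ ξ ∘ Φ

------------------------------------------------------------------------
-- Existence of ξ

one? : ∀ {n} {Q : Set} → Dec Q → (x : Fin n) → Decidable (λ j → j ≡ x × Q)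
one? d x j = (j Fin.≟ x) ×-dec d

one-count : ∀ {n} {Q : Set} (d : Dec Q) (x : Fin n) → # (one? d x) ≡ χ d
one-count (yes q) x = #-one (one? (yes q) x) x (refl , q) (λ _ → proj₁)
one-count (no ¬q) x = #-none (one? (no ¬q) x) (λ _ → ¬q ∘ proj₂)

cs-char : ∀ {k} (W : 𝔏 (suc k)) m → label W m ≡ 0 → (∀ i → m < i → label W i ≢ 0) → cs W ≡ m
cs-char {k} W m z after = max≈v⁺ (∈-filter⁺ zero? (∈-allFin m) z)
  (All.tabulate (λ {i} x → ℕ.≮⇒≥ (λ l → after i l (proj₂ (∈-filter⁻ zero? {xs = allFin (suc k)} x))))) z≤n
  where
  open Extrema (Fin.≤-totalOrder (suc k)) using (max≈v⁺)
  zero? = λ i → label W i ℕ.≟ 0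

Coded-cs : ∀ {k} {τ : Permutation′ (suc k)} (W : 𝔏 (suc k)) → Coded τ (step W) (label W) →
           ∀ m → toℕ (τ ⟨$⟩ʳ m) ≡ k → NE (step W m) × label W m ≡ 0 × cs W ≡ m
Coded-cs {k} {τ} W T m top = m-NE , m-0 , cs-char W m m-0 (λ i l → go i l (NE? (step W i)))
  where
  open Coded T
  m-NE : NE (step W m)
  m-NE = up⁻ m (subst (toℕ m ℕ.≤_) (sym top) (ℕ.≤-pred (Fin.toℕ<n m)))
  m-0 : label W m ≡ 0
  m-0 = trans (hi m m-NE) (#-none (X? τ m) (λ j (_ , l) → ℕ.<⇒≱ (subst (ℕ._< toℕ (τ ⟨$⟩ʳ j)) top l) (ℕ.≤-pred (Fin.toℕ<n (τ ⟨$⟩ʳ j)))))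
  go : ∀ i → m < i → Dec (NE (step W i)) → label W i ≢ 0
  go i l (no x) e with () ← trans (sym e) (lo i (¬NE⇒SdE x))
  go i l (yes x) e = ℕ.<⇒≢ (#-pos (X? τ i) m (l , ℕ.≤∧≢⇒< (subst (toℕ (τ ⟨$⟩ʳ i) ℕ.≤_) (sym top) (ℕ.≤-pred (Fin.toℕ<n (τ ⟨$⟩ʳ i)))) (λ p → ℕ.<-irrefl (cong toℕ (sym (trans (sym (inverseˡ τ)) (trans (cong (τ ⟨$⟩ˡ_) (Fin.toℕ-injective p)) (inverseˡ τ))))) l)))
    (sym (trans (sym (hi i x)) e))

module Flip {k} {τ τ′ : Permutation′ (suc k)} (W V : 𝔏 (suc k))
  (T : Coded τ (step W) (label W)) (T′ : Coded τ′ (step V) (label V)) (m : Fin (suc k))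
  (top : toℕ (τ ⟨$⟩ʳ m) ≡ k) (top′ : toℕ (τ′ ⟨$⟩ʳ opposite m) ≡ k)
  (τ-sum : ∀ i → i ≢ m → suc (toℕ (τ′ ⟨$⟩ʳ opposite i) + toℕ (τ ⟨$⟩ʳ i)) ≡ k) where
  module T = Coded T
  module T′ = Coded T′

  t t′ : Fin (suc k) → ℕ
  t i = toℕ (τ ⟨$⟩ʳ i)
  t′ i = toℕ (τ′ ⟨$⟩ʳ opposite i)

  opp-sum : ∀ (i : Fin (suc k)) → toℕ (opposite i) + toℕ i ≡ k
  opp-sum i = trans (cong (_+ toℕ i) (Fin.opposite-prop i)) (ℕ.m∸n+n≡m (ℕ.≤-pred (Fin.toℕ<n i)))

  -- x + y = k  and  1 + a + b = k
  below : ∀ {x y a b} → x + y ≡ k → suc (a + b) ≡ k → y ℕ.≤ b → a ℕ.< x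
  below {x} {y} {a} {b} p q l = ℕ.+-cancelʳ-< y a x (ℕ.≤-trans (s≤s (ℕ.+-monoʳ-≤ a l)) (ℕ.≤-reflexive (trans q (sym p))))

  above : ∀ {x y a b} → x + y ≡ k → suc (a + b) ≡ k → b ℕ.< y → x ℕ.≤ a
  above {x} {y} {a} {b} p q l = ℕ.+-cancelʳ-≤ y x a (ℕ.≤-trans (ℕ.≤-reflexive (trans p (sym q))) (subst (ℕ._≤ a + y) (ℕ.+-suc a b) (ℕ.+-monoʳ-≤ a l)))

  ≤t : ∀ i → t i ℕ.≤ k
  ≤t i = ℕ.≤-pred (Fin.toℕ<n (τ ⟨$⟩ʳ i))

  swap : ∀ i j → i ≢ m → j ≢ m → t i ℕ.< t j → t′ j ℕ.< t′ i
  swap i j a b l = ℕ.+-cancelʳ-< (t i) (t′ j) (t′ i) (ℕ.<-≤-trans (ℕ.+-monoʳ-< (t′ j) l)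
    (ℕ.≤-reflexive (ℕ.suc-injective (trans (τ-sum j b) (sym (τ-sum i a))))))

  swap⁻ : ∀ i j → i ≢ m → j ≢ m → t′ j ℕ.< t′ i → t i ℕ.< t j
  swap⁻ i j a b l = ℕ.+-cancelˡ-< (t′ j) (t i) (t j) (ℕ.<-≤-trans (ℕ.+-monoˡ-< (t i) l)
    (ℕ.≤-reflexive (ℕ.suc-injective (trans (τ-sum i a) (sym (τ-sum j b))))))

  t<m : ∀ i → i ≢ m → t i ℕ.< t m
  t<m i a = subst (t i ℕ.<_) (sym top) (ℕ.≤-trans (s≤s (ℕ.m≤n+m (t i) (t′ i))) (ℕ.≤-reflexive (τ-sum i a)))

  t′<m : ∀ i → i ≢ m → t′ i ℕ.< t′ m
  t′<m i a = subst (t′ i ℕ.<_) (sym top′) (ℕ.≤-trans (s≤s (ℕ.m≤m+n (t′ i) (t i))) (ℕ.≤-reflexive (τ-sum i a)))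

  NE⇒SdE : ∀ i → i ≢ m → NE (step V (opposite i)) → SdE (step W i)
  NE⇒SdE i a x = ¬NE⇒SdE (λ y → ℕ.<⇒≱ (below (opp-sum i) (τ-sum i a) (T.up i y)) (T′.up _ x))

  SdE⇒NE : ∀ i → i ≢ m → SdE (step W i) → NE (step V (opposite i))
  SdE⇒NE i a x = T′.up⁻ _ (above (opp-sum i) (τ-sum i a) (T.down i x))

  NE⇒SdE′ : ∀ i → i ≢ m → NE (step W i) → SdE (step V (opposite i))
  NE⇒SdE′ i a x = ¬NE⇒SdE (λ y → SdE⇒¬NE (NE⇒SdE i a y) x)

  heights : ∀ i → h V (opposite i) + χ (m ≤? i) ≡ h W i + χ (i ≤? τ ⟨$⟩ʳ i)
  heights i = trans (cong₂ _+_ g≡ (sym only-m)) (trans (sym split-m) (trans split-i (cong₂ _+_ (sym (T.height≡A (toℕ i))) only-i)))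
    where
    p = toℕ i
    C? = λ j → (j ≤? i) ×-dec (p ℕ.≤? t j)
    C′? = λ j → C? j ×-dec ¬? (j Fin.≟ m)
    only-m = one-count (m ≤? i) m
    only-i = one-count (i ≤? τ ⟨$⟩ʳ i) i
    g≡ : h V (opposite i) ≡ # C′?
    g≡ = trans (T′.height≡B (toℕ (opposite i))) (trans (#-permute (T′.B? (toℕ (opposite i))) reverse)
      (#-cong (λ j → T′.B? (toℕ (opposite i)) (opposite j)) C′? fwd bwd))
      where
      fwd : ∀ j → t′ j ℕ.< toℕ (opposite i) × opposite i ≤ opposite j → (j ≤ i × p ℕ.≤ t j) × j ≢ m
      fwd j (l , q) = (subst₂ _≤_ (opp-opp j) (opp-opp i) (opp-≤ q) , ℕ.≮⇒≥ (λ r → ℕ.<⇒≱ l (above (opp-sum i) (τ-sum j j≢m) r))) , j≢m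
        where
        j≢m : j ≢ m
        j≢m refl = ℕ.<⇒≱ (subst (ℕ._< toℕ (opposite i)) top′ l) (ℕ.≤-pred (Fin.toℕ<n (opposite i)))
      bwd : ∀ j → (j ≤ i × p ℕ.≤ t j) × j ≢ m → t′ j ℕ.< toℕ (opposite i) × opposite i ≤ opposite j
      bwd j ((l , q) , a) = below (opp-sum i) (τ-sum j a) q , opp-≤ l
    split-m : # C? ≡ # C′? + # (one? (m ≤? i) m)
    split-m = #-⊎ C? C′? (one? (m ≤? i) m) (λ j x → f j x (j Fin.≟ m)) (λ _ → proj₁)
      (λ { _ (refl , l) → l , subst (p ℕ.≤_) (sym top) (ℕ.≤-pred (Fin.toℕ<n i)) }) (λ _ (_ , a) (b , _) → a b)
      where
      f : ∀ j → j ≤ i × p ℕ.≤ t j → Dec (j ≡ m) → ((j ≤ i × p ℕ.≤ t j) × j ≢ m) ⊎ (j ≡ m × m ≤ i)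
      f j x (no a) = inj₁ (x , a)
      f j x (yes refl) = inj₂ (refl , proj₁ x)
    split-i : # C? ≡ # (T.A? p) + # (one? (i ≤? τ ⟨$⟩ʳ i) i)
    split-i = #-⊎ C? (T.A? p) (one? (i ≤? τ ⟨$⟩ʳ i) i) (λ j (l , q) → f j q (ℕ.m≤n⇒m<n∨m≡n l)) (λ j (l , q) → ℕ.<⇒≤ l , q)
      (λ { _ (refl , l) → ℕ.≤-refl , l }) (λ { _ (l , _) (refl , _) → ℕ.<-irrefl refl l })
      where
      f : ∀ j → p ℕ.≤ t j → j < i ⊎ toℕ j ≡ toℕ i → (j < i × p ℕ.≤ t j) ⊎ (j ≡ i × i ≤ τ ⟨$⟩ʳ i)
      f j q (inj₁ l) = inj₁ (l , q)
      f j q (inj₂ e) with refl ← Fin.toℕ-injective {i = j} {i} e = inj₂ (refl , q)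

  heights-NE : ∀ i → NE (step W i) → h V (opposite i) + χ (m ≤? i) ≡ h W i + 1
  heights-NE i x = trans (heights i) (cong (h W i +_) (χ-yes (i ≤? τ ⟨$⟩ʳ i) (T.up i x)))

  heights-SdE : ∀ i → SdE (step W i) → h V (opposite i) + χ (m ≤? i) ≡ h W i
  heights-SdE i x = trans (heights i) (trans (cong (h W i +_) (χ-no (i ≤? τ ⟨$⟩ʳ i) (SdE⇒¬NE x ∘ T.up⁻ i))) (ℕ.+-identityʳ _))

  labels-NE : ∀ i → i ≢ m → NE (step W i) → label V (opposite i) + χ (m ≤? i) ≡ suc (label W i)
  labels-NE i a x = trans (cong (_+ χ (m ≤? i)) (T′.lo _ (NE⇒SdE′ i a x)))
    (cong suc (trans (cong (# (Y? τ′ (opposite i)) +_) (sym (one-count (m ≤? i) m)))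
      (trans (cong (_+ # (one? (m ≤? i) m)) (#-permute (Y? τ′ (opposite i)) reverse))
      (trans (sym (#-⊎ (X? τ i) (λ j → Y? τ′ (opposite i) (opposite j)) (one? (m ≤? i) m) (λ j (l , q) → f j l q (j Fin.≟ m))
        (λ j (l , q) → let b = λ e → j≢m j e q in subst₂ _<_ (opp-opp j) (opp-opp i) (opp-< l) , swap⁻ i j a b q)
        (λ { _ (refl , l) → ℕ.≤∧≢⇒< l (λ e → a (sym (Fin.toℕ-injective e))) , t<m i a })
        (λ j (_ , q) (e , _) → j≢m j e q))) (sym (T.hi i x))))))
    where
    j≢m : ∀ j → j ≡ m → t′ j ℕ.< t′ i → ⊥
    j≢m _ refl l = ℕ.<-asym l (t′<m i a)
    f : ∀ j → j < i → t i ℕ.< t j → Dec (j ≡ m) → (opposite i < opposite j × t′ j ℕ.< t′ i) ⊎ (j ≡ m × m ≤ i)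
    f j l q (yes refl) = inj₂ (refl , ℕ.<⇒≤ l)
    f j l q (no b) = inj₁ (opp-< l , swap i j a b q)

  labels-SdE : ∀ i → SdE (step W i) → label V (opposite i) + χ (m ≤? i) ≡ label W i
  labels-SdE i x = trans (cong (_+ χ (m ≤? i)) (T′.hi _ (SdE⇒NE i a x))) (trans (cong (_+ χ (m ≤? i)) count)
      (trans (ℕ.+-assoc (# (Y? τ i)) _ _) (trans (cong (# (Y? τ i) +_) compl) (trans (ℕ.+-comm _ 1) (sym (T.lo i x))))))
    where
    a : i ≢ m
    a refl = ℕ.<⇒≱ (T.down m x) (subst (toℕ m ℕ.≤_) (sym top) (ℕ.≤-pred (Fin.toℕ<n m)))
    compl : χ (i <? m) + χ (m ≤? i) ≡ 1
    compl = trans (sym (χ-⊎ (yes tt) (i <? m) (m ≤? i) (λ _ → f (i <? m)) _ _ ℕ.<⇒≱)) refl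
      where
      f : Dec (i < m) → i < m ⊎ m ≤ i
      f (yes l) = inj₁ l
      f (no l) = inj₂ (ℕ.≮⇒≥ l)
    j≢m : ∀ j → t j ℕ.< t i → j ≢ m
    j≢m _ l refl = ℕ.<-asym l (t<m i a)
    count : # (X? τ′ (opposite i)) ≡ # (Y? τ i) + χ (i <? m)
    count = trans (#-permute (X? τ′ (opposite i)) reverse) (trans
      (#-⊎ (λ j → X? τ′ (opposite i) (opposite j)) (Y? τ i) (one? (i <? m) m) (λ j (l , q) → f j (subst₂ _<_ (opp-opp i) (opp-opp j) (opp-< l)) q (j Fin.≟ m))
        (λ j (l , q) → opp-< l , swap j i (j≢m j q) a q)
        (λ { _ (refl , l) → opp-< l , t′<m i a })
        (λ { j (_ , q) (e , _) → j≢m j q e }))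
      (cong (# (Y? τ i) +_) (one-count (i <? m) m)))
      where
      f : ∀ j → i < j → t′ i ℕ.< t′ j → Dec (j ≡ m) → (i < j × t j ℕ.< t i) ⊎ (j ≡ m × i < m)
      f j l q (yes refl) = inj₂ (refl , l)
      f j l q (no b) = inj₁ (l , swap⁻ j i b a q)

  mW = Coded-cs W T m top
  mV = Coded-cs V T′ (opposite m) top′

  label-law : ∀ i → label V (opposite i) + h W i ≡ h V (opposite i) + label W i
  label-law i = go (NE? (step W i)) (i Fin.≟ m)
    where
    b = label V (opposite i)
    c = label W i
    g = h V (opposite i)
    e = h W i
    y = χ (m ≤? i)
    arith₁ : ∀ b e y → b + e + y ≡ b + y + e
    arith₁ = solve-∀
    arith₂ : ∀ c e → suc c + e ≡ (e + 1) + c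
    arith₂ = solve-∀
    arith₃ : ∀ g y c → g + y + c ≡ g + c + y
    arith₃ = solve-∀
    arith₄ : ∀ b g y → b + (g + y) ≡ g + (b + y)
    arith₄ = solve-∀
    go : Dec (NE (step W i)) → Dec (i ≡ m) → b + e ≡ g + c
    go (yes x) (no a) = ℕ.+-cancelʳ-≡ y _ _ (trans (arith₁ b e y) (trans (cong (_+ e) (labels-NE i a x))
      (trans (arith₂ c e) (trans (cong (_+ c) (sym (heights-NE i x))) (arith₃ g y c)))))
    go (no x) _ = trans (cong (b +_) (sym (heights-SdE i (¬NE⇒SdE x)))) (trans (arith₄ b g y) (cong (g +_) (labels-SdE i (¬NE⇒SdE x))))
    go (yes x) (yes refl) = trans (cong (_+ e) (proj₁ (proj₂ mV))) (trans
      (ℕ.+-cancelʳ-≡ 1 _ _ (trans (sym (heights-NE i x)) (cong (g +_) (χ-yes (m ≤? m) ℕ.≤-refl))))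
      (trans (sym (ℕ.+-identityʳ _)) (cong (g +_) (sym (proj₁ (proj₂ mW))))))

  up-law : ∀ i → opposite m < opposite i → SdE (step V (opposite i)) → h V (opposite i) ≡ h W i + 1
  up-law i l x = trans (sym (ℕ.+-identityʳ _)) (trans (cong (h V (opposite i) +_) (sym (χ-no (m ≤? i) (ℕ.<⇒≱ i<m))))
      (heights-NE i (nonSdE (NE? (step W i)))))
    where
    i<m : i < m
    i<m = subst₂ _<_ (opp-opp i) (opp-opp m) (opp-< l)
    nonSdE : Dec (NE (step W i)) → NE (step W i)
    nonSdE (yes y) = y
    nonSdE (no y) = contradiction (SdE⇒NE i (λ { refl → ℕ.<-irrefl refl i<m }) (¬NE⇒SdE y)) (SdE⇒¬NE x)

  down-law : ∀ i → opposite i < opposite m → NE (step V (opposite i)) → h V (opposite i) + 1 ≡ h W i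
  down-law i l x = trans (cong (h V (opposite i) +_) (sym (χ-yes (m ≤? i) (ℕ.<⇒≤ m<i))))
      (heights-SdE i (NE⇒SdE i (λ { refl → ℕ.<-irrefl refl m<i }) x))
    where
    m<i : m < i
    m<i = subst₂ _<_ (opp-opp m) (opp-opp i) (opp-< l)

  same-law : ∀ i → ¬ (opposite m < opposite i × SdE (step V (opposite i))) → ¬ (opposite i < opposite m × NE (step V (opposite i))) →
             h V (opposite i) ≡ h W i
  same-law i p q = go (Fin.<-cmp i m) (NE? (step V (opposite i)))
    where
    go : Tri (i < m) (i ≡ m) (m < i) → Dec (NE (step V (opposite i))) → h V (opposite i) ≡ h W i
    go (tri< l a _) (yes x) = trans (sym (ℕ.+-identityʳ _)) (trans (cong (h V (opposite i) +_) (sym (χ-no (m ≤? i) (ℕ.<⇒≱ l))))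
      (heights-SdE i (NE⇒SdE i a x)))
    go (tri< l _ _) (no x) = contradiction (opp-< l , ¬NE⇒SdE x) p
    go (tri> _ _ l) (yes x) = contradiction (opp-< l , x) q
    go (tri> _ a l) (no x) = ℕ.+-cancelʳ-≡ 1 _ _ (trans (cong (h V (opposite i) +_) (sym (χ-yes (m ≤? i) (ℕ.<⇒≤ l)))) (heights-NE i (nonSdE (NE? (step W i)))))
      where
      nonSdE : Dec (NE (step W i)) → NE (step W i)
      nonSdE (yes y) = y
      nonSdE (no y) = contradiction (SdE⇒NE i a (¬NE⇒SdE y)) x
    go (tri≈ _ refl _) _ = ℕ.+-cancelʳ-≡ 1 _ _ (trans (cong (h V (opposite m) +_) (sym (χ-yes (m ≤? m) ℕ.≤-refl))) (heights-NE m (proj₁ mW)))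

-- π′(n+1−i) = n+2−π(i) for π(i) ≠ 1, and π′(n+1−pone) = 1
turn : ∀ {k} → 𝔖 (suc k) → 𝔖 (suc k)
turn π = reverse ∘ₚ (π ∘ₚ lift₀ reverse)

turn-turn : ∀ {k} (π : 𝔖 (suc k)) → turn (turn π) ≈ π
turn-turn π i = trans (neg-neg _) (cong (π ⟨$⟩ʳ_) (opp-opp i))
  where
  neg-neg : ∀ {k} (v : Fin (suc k)) → lift₀ reverse ⟨$⟩ʳ (lift₀ reverse ⟨$⟩ʳ v) ≡ v
  neg-neg zero = refl
  neg-neg (suc v) = cong suc (opp-opp v)

ξ₀ : ∀ {k} → 𝔏 (suc k) → 𝔏 (suc k)
ξ₀ W = Φ (turn (Φ⁻¹ W))

≋-trans : ∀ {n} {U V W : 𝔏 n} → U ≋ V → V ≋ W → U ≋ W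
≋-trans (a , b) (c , d) = (λ i → trans (a i) (c i)) , (λ i → trans (b i) (d i))

ξ₀-isXi : ∀ {k} → IsXi (ξ₀ {k})
ξ₀-isXi {k} = record
  { involutive = λ W → ≋-trans {U = ξ₀ (ξ₀ W)} {Φ (Φ⁻¹ W)} {W}
      (Φ-cong (turn (Φ⁻¹ (ξ₀ W))) (Φ⁻¹ W) (λ i → trans (cong (lift₀ reverse ⟨$⟩ʳ_) (Φ⁻¹∘Φ (turn (Φ⁻¹ W)) (opposite i))) (turn-turn (Φ⁻¹ W) i)))
      (Φ∘Φ⁻¹ W)
  ; cs-ξ = λ W → trans (proj₂ (proj₂ (F.mV W))) (cong opposite (sym (m≡ W)))
  ; step-ξ = λ W j a → let a′ = λ e → a (trans (sym (opp-opp j)) (cong opposite (trans e (sym (m≡ W))))) in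
      mk⇔ (λ x → F.NE⇒SdE W (opposite j) a′ (subst (NE ∘ step (ξ₀ W)) (sym (opp-opp j)) x))
          (λ x → subst (NE ∘ step (ξ₀ W)) (opp-opp j) (F.SdE⇒NE W (opposite j) a′ x))
  ; h-up = λ W → at W (λ i m → opposite m < i → SdE (step (ξ₀ W) i) → h (ξ₀ W) i ≡ h W (opposite i) + 1)
      (λ i → subst (λ z → opposite (m W) < opposite i → SdE (step (ξ₀ W) (opposite i)) → h (ξ₀ W) (opposite i) ≡ h W z + 1) (sym (opp-opp i)) (F.up-law W i))
  ; h-down = λ W → at W (λ i m → i < opposite m → NE (step (ξ₀ W) i) → h (ξ₀ W) i + 1 ≡ h W (opposite i))
      (λ i → subst (λ z → opposite i < opposite (m W) → NE (step (ξ₀ W) (opposite i)) → h (ξ₀ W) (opposite i) + 1 ≡ h W z) (sym (opp-opp i)) (F.down-law W i))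
  ; h-same = λ W → at W (λ i m → ¬ (opposite m < i × SdE (step (ξ₀ W) i)) → ¬ (i < opposite m × NE (step (ξ₀ W) i)) → h (ξ₀ W) i ≡ h W (opposite i))
      (λ i → subst (λ z → ¬ (opposite (m W) < opposite i × SdE (step (ξ₀ W) (opposite i))) → ¬ (opposite i < opposite (m W) × NE (step (ξ₀ W) (opposite i))) → h (ξ₀ W) (opposite i) ≡ h W z) (sym (opp-opp i)) (F.same-law W i))
  ; label-ξ = λ W → at W (λ i m → label (ξ₀ W) i + h W (opposite i) ≡ h (ξ₀ W) i + label W (opposite i))
      (λ i → subst (λ z → label (ξ₀ W) (opposite i) + h W z ≡ h (ξ₀ W) (opposite i) + label W z) (sym (opp-opp i)) (F.label-law W i))
  }
  where
  m : 𝔏 (suc k) → Fin (suc k)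
  m W = pone (Φ⁻¹ W)
  module F (W : 𝔏 (suc k)) where
    π = Φ⁻¹ W
    σ = turn π
    module P = Shift π
    module Q = Shift σ
    σ-opp : ∀ i → σ ⟨$⟩ʳ opposite i ≡ lift₀ reverse ⟨$⟩ʳ (π ⟨$⟩ʳ i)
    σ-opp i = cong (λ z → lift₀ reverse ⟨$⟩ʳ (π ⟨$⟩ʳ z)) (opp-opp i)
    opp-m : opposite (m W) ≡ pone σ
    opp-m = Q.is-m _ (trans (σ-opp (m W)) (cong (lift₀ reverse ⟨$⟩ʳ_) P.π-m))
    τ-sum : ∀ i → i ≢ m W → suc (toℕ (shift σ ⟨$⟩ʳ opposite i) + toℕ (shift π ⟨$⟩ʳ i)) ≡ k
    τ-sum i a = ℕ.suc-injective (trans (cong suc (sym (ℕ.+-suc _ _))) (trans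
      (cong₂ _+_ (trans (Q.τ-¬m (opposite i) (λ e → a (opp-injective (trans e (sym opp-m))))) (cong toℕ (σ-opp i))) (P.τ-¬m i a))
      (neg-sum (π ⟨$⟩ʳ i) (λ e → a (P.is-m i e)))))
      where
      neg-sum : ∀ v → v ≢ zero → toℕ (lift₀ (reverse {k}) ⟨$⟩ʳ v) + toℕ v ≡ suc k
      neg-sum zero b = contradiction refl b
      neg-sum (suc v) b = trans (cong (λ z → suc z + suc (toℕ v)) (Fin.opposite-prop v)) (cong suc (ℕ.m∸n+n≡m (Fin.toℕ<n v)))
    open Flip W (ξ₀ W) (Φ⁻¹-coded W) (Φ-coded σ) (m W) P.τ-m (trans (cong (λ z → toℕ (shift σ ⟨$⟩ʳ z)) opp-m) Q.τ-m) τ-sum public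
  m≡ : ∀ W → cs W ≡ m W
  m≡ W = proj₂ (proj₂ (F.mW W))
  at : ∀ W (P : Fin (suc k) → Fin (suc k) → Set) → (∀ i → P (opposite i) (m W)) → ∀ j → P j (cs W)
  at W P f j = subst₂ P (opp-opp j) (sym (m≡ W)) (f (opposite j))

{-# OPTIONS --safe #-}
module Submission where

open import Data.Fin using (Fin; zero; suc; toℕ; fromℕ<; inject₁; opposite; _<_; _≤_; _<?_; _≤?_)
open import Data.Fin.Permutation using (_⟨$⟩ʳ_; _⟨$⟩ˡ_; _≈_; inverseˡ; inverseʳ; reverse; lift₀)
import Data.Fin.Properties as Fin
open import Data.Nat using (ℕ; suc; _+_; _∸_)
import Data.Nat as ℕ
import Data.Nat.Properties as ℕ
open import Data.Nat.Tactic.RingSolver using (solve-∀)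
open import Data.Product using (_×_; _,_; proj₁; proj₂)
open import Data.Sum using (_⊎_; inj₁; inj₂)
open import Data.Unit using (tt)
open import Function using (_∘_)
open import Function.Bundles using (module Equivalence)
open import Relation.Binary.Definitions using (Tri; tri<; tri≈; tri>)
open import Relation.Binary.PropositionalEquality
open import Relation.Nullary using (Dec; yes; no; ¬_; contradiction)
open import Relation.Nullary.Decidable using (_×-dec_; ¬?)
open import Defs

-- A history is determined by its heights, its labels and the positions of its
-- letters N and E, so at most one map satisfies the properties defining ξ, and it is
-- `ξ₀`, for which ρ π is the permutation `turn π` given by n + 1 − i ↦ n + 2 − π(i)
-- (and by n + 1 − pone π ↦ 1).  On the histories, Vedif is the height and
-- Vnest ⊔ Vnepb ⊔ Vnepa is the label, so the multiset identities compare the heights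
-- and labels of π and `turn π`.

open 𝔏

-- Uniqueness of ξ.

before-suc : ∀ {n} (w : Fin n → Step) s i →
             before w s (suc (toℕ i)) ≡ before w s (toℕ i) + χ (w i ≟ s)
before-suc w s i = trans
  (#-⊎ (λ j → (toℕ j ℕ.<? suc (toℕ i)) ×-dec (w j ≟ s)) (λ j → (toℕ j ℕ.<? toℕ i) ×-dec (w j ≟ s)) (one? (w i ≟ s) i)
    (λ j (l , e) → split j e (ℕ.m<1+n⇒m<n∨m≡n l)) (λ j (l , e) → ℕ.m<n⇒m<1+n l , e)
    (λ { _ (refl , e) → ℕ.≤-refl , e }) (λ { _ (l , _) (refl , _) → ℕ.<-irrefl refl l }))
  (cong (before w s (toℕ i) +_) (one-count (w i ≟ s) i))
  where
  split : ∀ j → w j ≡ s → j < i ⊎ toℕ j ≡ toℕ i → (j < i × w j ≡ s) ⊎ (j ≡ i × w i ≡ s)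
  split j e (inj₁ l) = inj₁ (l , e)
  split j e (inj₂ p) with refl ← Fin.toℕ-injective {i = j} {i} p = inj₂ (refl , e)

-- The recurrence for heights with its negative term moved across. The truncated difference in
-- `height` is exact at both i and i + 1 by `nonneg`, so it follows from the counts of N and S in a
-- prefix.
height-suc : ∀ {n} (W : 𝔏 n) i →
             h W i + χ (step W i ≟ N) ≡ χ (step W i ≟ S) + height (step W) (suc (toℕ i))
height-suc W i = ℕ.+-cancelˡ-≡ (before w S p) _ _ (begin
  before w S p + (height w p + χ (w i ≟ N))       ≡⟨ ℕ.+-assoc (before w S p) _ _ ⟨
  before w S p + height w p + χ (w i ≟ N)         ≡⟨ cong (_+ χ (w i ≟ N)) (N≡S+h p (ℕ.<⇒≤ (Fin.toℕ<n i))) ⟨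
  before w N p + χ (w i ≟ N)                      ≡⟨ before-suc w N i ⟨
  before w N (suc p)                              ≡⟨ N≡S+h (suc p) (Fin.toℕ<n i) ⟩
  before w S (suc p) + height w (suc p)           ≡⟨ cong (_+ height w (suc p)) (before-suc w S i) ⟩
  before w S p + χ (w i ≟ S) + height w (suc p)   ≡⟨ ℕ.+-assoc (before w S p) _ _ ⟩
  before w S p + (χ (w i ≟ S) + height w (suc p)) ∎)
  where
  open ≡-Reasoning
  open Decode W using (N≡S+h)
  w = step W
  p = toℕ i

height-closed : ∀ {n} (W : 𝔏 n) → height (step W) n ≡ 0
height-closed {n} W = trans (cong (before (step W) N n ∸_) (closed W)) (ℕ.n∸n≡0 (before (step W) N n))

-- The equation says that both letters change the height by the same amount. The omitted pairs, N
-- with E and S with dE, are those that it refutes by computation.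
step-from-heights : ∀ {s t} → (NE s → NE t) → (NE t → NE s) →
                    χ (s ≟ N) + χ (t ≟ S) ≡ χ (t ≟ N) + χ (s ≟ S) → s ≡ t
step-from-heights {N}  {N}  f g e = refl
step-from-heights {N}  {S}  f g e with () ← f N
step-from-heights {N}  {dE} f g e with () ← f N
step-from-heights {S}  {N}  f g e with () ← g N
step-from-heights {S}  {S}  f g e = refl
step-from-heights {S}  {E}  f g e with () ← g E
step-from-heights {E}  {S}  f g e with () ← f E
step-from-heights {E}  {E}  f g e = refl
step-from-heights {E}  {dE} f g e with () ← f E
step-from-heights {dE} {N}  f g e with () ← g N
step-from-heights {dE} {E}  f g e with () ← g E
step-from-heights {dE} {dE} f g e = refl

steps-determined : ∀ {n} (U V : 𝔏 n) → (∀ i → h U i ≡ h V i) →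
                   (∀ i → NE (step U i) → NE (step V i)) → (∀ i → NE (step V i) → NE (step U i)) →
                   ∀ i → step U i ≡ step V i
steps-determined {n} U V h≡ f g i = step-from-heights (f i) (g i)
  -- Adding the current and the next height to both sides makes the recurrences of U and V
  -- applicable.
  (ℕ.+-cancelˡ-≡ (h U i + height (step V) (suc (toℕ i))) _ _ (begin
    (h U i + b) + (χ (u ≟ N) + χ (v ≟ S)) ≡⟨ arith₁ (h U i) b (χ (u ≟ N)) (χ (v ≟ S)) ⟩
    (h U i + χ (u ≟ N)) + (χ (v ≟ S) + b) ≡⟨ cong₂ _+_ (height-suc U i) (sym (height-suc V i)) ⟩
    (χ (u ≟ S) + a) + (h V i + χ (v ≟ N)) ≡⟨ cong₂ (λ x y → (χ (u ≟ S) + x) + (y + χ (v ≟ N))) a≡b (sym (h≡ i)) ⟩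
    (χ (u ≟ S) + b) + (h U i + χ (v ≟ N)) ≡⟨ arith₂ (h U i) b (χ (v ≟ N)) (χ (u ≟ S)) ⟩
    (h U i + b) + (χ (v ≟ N) + χ (u ≟ S)) ∎))
  where
  open ≡-Reasoning
  u = step U i
  v = step V i
  a = height (step U) (suc (toℕ i))
  b = height (step V) (suc (toℕ i))
  arith₁ : ∀ x b y z → (x + b) + (y + z) ≡ (x + y) + (z + b)
  arith₁ = solve-∀
  arith₂ : ∀ x b y z → (z + b) + (x + y) ≡ (x + b) + (y + z)
  arith₂ = solve-∀
  heights≡ : ∀ p → p ℕ.< n ⊎ p ≡ n → height (step U) p ≡ height (step V) p
  heights≡ p (inj₁ l) = subst (λ q → height (step U) q ≡ height (step V) q) (Fin.toℕ-fromℕ< l) (h≡ (fromℕ< l))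
  -- `h` stops before the last letter; the height after it is 0 for both paths.
  heights≡ p (inj₂ refl) = trans (height-closed U) (sym (height-closed V))
  a≡b : a ≡ b
  a≡b = heights≡ (suc (toℕ i)) (ℕ.m≤n⇒m<n∨m≡n (Fin.toℕ<n i))

-- `step-ξ` is silent at one position, which `cs-ξ` identifies as the `cs` of the image. Every
-- history codes a permutation, and `cs` is the position that its shift sends to n; such a position
-- cannot be sent below itself.
NE-cs : ∀ {k} (W : 𝔏 (suc k)) → NE (step W (cs W))
NE-cs W =
  let x , _ , e = Coded-cs W (Φ⁻¹-coded W) (pone (Φ⁻¹ W)) (Shift.τ-m (Φ⁻¹ W))
  in subst (NE ∘ step W) (sym e) x

module _ {k} {ξ ζ : 𝔏 (suc k) → 𝔏 (suc k)} (X : IsXi ξ) (Z : IsXi ζ) (W : 𝔏 (suc k)) where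
  private
    module X = IsXi X
    module Z = IsXi Z

  -- Away from the exceptional position both sides are governed by the same letter of W; at that
  -- position `NE-cs` applies. The converse is the instance with ξ and ζ exchanged.
  isXi-NE : ∀ j → NE (step (ξ W) j) → NE (step (ζ W) j)
  isXi-NE j x with j Fin.≟ opposite (cs W)
  ... | yes refl = subst (NE ∘ step (ζ W)) (Z.cs-ξ W) (NE-cs (ζ W))
  ... | no a = Equivalence.from (Z.step-ξ W j a) (Equivalence.to (X.step-ξ W j a) x)

module _ {k} {ξ ζ : 𝔏 (suc k) → 𝔏 (suc k)} (X : IsXi ξ) (Z : IsXi ζ) (W : 𝔏 (suc k)) where
  private
    module X = IsXi X
    module Z = IsXi Z

  -- Which of the three height rules applies depends only on j and on the class of the letter, and ξ
  -- and ζ agree on the class.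
  isXi-h : ∀ j → h (ξ W) j ≡ h (ζ W) j
  isXi-h j with (opposite (cs W) <? j) ×-dec SdE? (step (ξ W) j)
  ... | yes (l , x) = trans (X.h-up W j l x)
    (sym (Z.h-up W j l (¬NE⇒SdE (SdE⇒¬NE x ∘ isXi-NE Z X W j))))
  ... | no ¬up with (j <? opposite (cs W)) ×-dec NE? (step (ξ W) j)
  ...   | yes (l , x) = ℕ.+-cancelʳ-≡ 1 _ _ (trans (X.h-down W j l x) (sym (Z.h-down W j l (isXi-NE X Z W j x))))
  ...   | no ¬down = trans (X.h-same W j ¬up ¬down) (sym (Z.h-same W j
    (λ (l , x) → ¬up (l , ¬NE⇒SdE (SdE⇒¬NE x ∘ isXi-NE X Z W j)))
    (λ (l , x) → ¬down (l , isXi-NE Z X W j x))))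

  isXi-unique : ξ W ≋ ζ W
  isXi-unique = steps-determined (ξ W) (ζ W) isXi-h (isXi-NE X Z W) (isXi-NE Z X W) ,
    λ j → ℕ.+-cancelʳ-≡ (h W (opposite j)) _ _ (trans (X.label-ξ W j)
      (trans (cong (_+ label W (opposite j)) (isXi-h j)) (sym (Z.label-ξ W j))))

-- `Φ` sends the left side to ξ (Φ π) and `turn (Φ⁻¹ (Φ π))` to `ξ₀ (Φ π)`. These agree by
-- uniqueness, and `Φ` is injective.
ρ≈turn : ∀ {k} {ξ : 𝔏 (suc k) → 𝔏 (suc k)} → IsXi ξ → ∀ π → ρ ξ π ≈ turn π
ρ≈turn {ξ = ξ} X π i = trans
  (Φ-injective (ρ ξ π) (turn (Φ⁻¹ (Φ π)))
    (≋-trans {U = Φ (ρ ξ π)} {ξ (Φ π)} {ξ₀ (Φ π)} (Φ∘Φ⁻¹ (ξ (Φ π))) (isXi-unique X ξ₀-isXi (Φ π))) i)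
  (cong (lift₀ reverse ⟨$⟩ʳ_) (Φ⁻¹∘Φ π (opposite i)))

-- Statistics of a permutation read off its history.

NE-pos : ∀ {k} (π : 𝔖 (suc k)) i → NE (Φ-step π i) → i ≡ pone π ⊎ i < π ⟨$⟩ʳ i
NE-pos π i x = Shift.up-π⁻ π i (Coded.up (Φ-coded π) i x)

pos-NE : ∀ {k} (π : 𝔖 (suc k)) i → i ≡ pone π ⊎ i < π ⟨$⟩ʳ i → NE (Φ-step π i)
pos-NE π i x = Coded.up⁻ (Φ-coded π) i (Shift.up-π π i x)

Nep-SdE : ∀ {k} (π : 𝔖 (suc k)) i → i ≢ pone π → π ⟨$⟩ʳ i ≤ i → SdE (Φ-step π i)
Nep-SdE π i a l = ¬NE⇒SdE (λ x → bad (NE-pos π i x))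
  where
  bad : ¬ (i ≡ pone π ⊎ i < π ⟨$⟩ʳ i)
  bad (inj₁ e) = a e
  bad (inj₂ m) = ℕ.<⇒≱ m l

SdE-Nep : ∀ {k} (π : 𝔖 (suc k)) i → SdE (Φ-step π i) → π ⟨$⟩ʳ i ≤ i
SdE-Nep π i x = ℕ.≮⇒≥ (λ l → SdE⇒¬NE x (pos-NE π i (inj₂ l)))

-- With τ = `shift π`, the height at v counts the i < v with v ≤ τ(i). For i other than pone, τ(i) =
-- π(i) - 1, which gives v < π(i); and τ(pone) = n gives the extra interval after pone.
Vedif≡h : ∀ {k} (π : 𝔖 (suc k)) v → Vedif π v ≡ h (Φ π) v
Vedif≡h π v = trans
  (cong (# (λ i → Ep? π i ×-dec ((i <? v) ×-dec (v <? π ⟨$⟩ʳ i))) +_) (sym (one-count (m <? v) m)))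
  (sym (trans (height≡A (toℕ v)) (#-⊎ (A? (toℕ v))
    (λ i → Ep? π i ×-dec ((i <? v) ×-dec (v <? π ⟨$⟩ʳ i))) (one? (m <? v) m)
    (λ i (l , q) → split i l q (i Fin.≟ m))
    (λ i (_ , l , q) → l , ℕ.≤-pred (subst (toℕ v ℕ.<_) (sym (τ-¬m i (exceeds q))) q))
    (λ { _ (refl , l) → l , subst (toℕ v ℕ.≤_) (sym τ-m) (top v) })
    (λ { _ (_ , _ , q) (refl , _) → none v q }))))
  where
  open Labels π
  open Shift π
  split : ∀ i → i < v → v ≤ τ ⟨$⟩ʳ i → Dec (i ≡ m) →
          (i < π ⟨$⟩ʳ i × i < v × v < π ⟨$⟩ʳ i) ⊎ (i ≡ m × m < v)
  split i l q (yes refl) = inj₂ (refl , l)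
  split i l q (no a) = inj₁ (ℕ.<-trans l v<πi , l , v<πi)
    where
    v<πi : v < π ⟨$⟩ʳ i
    v<πi = subst (toℕ v ℕ.<_) (τ-¬m i a) (ℕ.s≤s q)

-- The position pone is a non-excedance with letter N or E, but it lies neither before nor after
-- itself. All other non-excedances carry S or dE.
Vnep≡SdE : ∀ {k} (π : 𝔖 (suc k)) i → Vnepb π i + Vnepa π i ≡ χ (SdE? (Φ-step π i))
Vnep≡SdE π i = sym (χ-⊎ (SdE? (Φ-step π i)) (Nep? π i ×-dec (i <? pone π)) (Nep? π i ×-dec (pone π <? i))
  (λ x → split x (Fin.<-cmp i (pone π)))
  (λ (l , b) → Nep-SdE π i (λ { refl → ℕ.<-irrefl refl b }) l)
  (λ (l , b) → Nep-SdE π i (λ { refl → ℕ.<-irrefl refl b }) l)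
  (λ (_ , b) (_ , c) → ℕ.<-asym b c))
  where
  split : SdE (Φ-step π i) → Tri (i < pone π) (i ≡ pone π) (pone π < i) →
          (π ⟨$⟩ʳ i ≤ i × i < pone π) ⊎ (π ⟨$⟩ʳ i ≤ i × pone π < i)
  split x (tri< l _ _) = inj₁ (SdE-Nep π i x , l)
  split x (tri≈ _ e _) = contradiction (pos-NE π i (inj₁ e)) (SdE⇒¬NE x)
  split x (tri> _ _ l) = inj₂ (SdE-Nep π i x , l)

-- Successive truncated subtractions merge into the subtraction of a sum, and that sum is the label.
Vedif∖≡h∸label : ∀ {k} (π : 𝔖 (suc k)) i →
                 (Vedif π ∖ Vnepb π ∖ Vnepa π ∖ Vnest π) i ≡ h (Φ π) i ∸ label (Φ π) i
Vedif∖≡h∸label π i = begin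
  Vedif π i ∸ Vnepb π i ∸ Vnepa π i ∸ vnest π i   ≡⟨ cong (_∸ vnest π i) (ℕ.∸-+-assoc (Vedif π i) (Vnepb π i) (Vnepa π i)) ⟩
  Vedif π i ∸ (Vnepb π i + Vnepa π i) ∸ vnest π i ≡⟨ ℕ.∸-+-assoc (Vedif π i) (Vnepb π i + Vnepa π i) (vnest π i) ⟩
  Vedif π i ∸ (Vnepb π i + Vnepa π i + vnest π i) ≡⟨ cong₂ (λ x y → x ∸ (y + vnest π i)) (Vedif≡h π i) (Vnep≡SdE π i) ⟩
  h (Φ π) i ∸ (χ (SdE? (Φ-step π i)) + vnest π i) ≡⟨ cong (h (Φ π) i ∸_) (ℕ.+-comm (χ (SdE? (Φ-step π i))) (vnest π i)) ⟩
  h (Φ π) i ∸ label (Φ π) i                       ∎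
  where open ≡-Reasoning

-- Excedance values, and the relation between π and ρ(π).

χ-∸-¬ : {A B : Set} (a : Dec A) (b : Dec B) → (A → B) → (B → A) → 1 ∸ χ (¬? a) ≡ χ b
χ-∸-¬ (yes a) b f g = sym (χ-yes b (f a))
χ-∸-¬ (no ¬a) b f g = sym (χ-no b (¬a ∘ g))

Exc⇒ : ∀ {k} (π : 𝔖 (suc k)) v → Exc π v → π ⟨$⟩ˡ v < v
Exc⇒ π v (i , l , refl) = subst (_< π ⟨$⟩ʳ i) (sym (inverseˡ π)) l

⇒Exc : ∀ {k} (π : 𝔖 (suc k)) v → π ⟨$⟩ˡ v < v → Exc π v
⇒Exc π v l = π ⟨$⟩ˡ v , subst (π ⟨$⟩ˡ v <_) (sym (inverseʳ π)) l , inverseʳ π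

-- A pointwise relation, because `ρ ξ π` agrees with `turn π` only up to `≈`. It is symmetric, so
-- each transfer result can also be applied from σ to π.
Turned : ∀ {k} → 𝔖 (suc k) → 𝔖 (suc k) → Set
Turned π σ = ∀ i → σ ⟨$⟩ʳ opposite i ≡ lift₀ reverse ⟨$⟩ʳ (π ⟨$⟩ʳ i)

Turned-sym : ∀ {k} {π σ : 𝔖 (suc k)} → Turned π σ → Turned σ π
Turned-sym {π = π} {σ} T i = begin
  π ⟨$⟩ʳ opposite i                                              ≡⟨ inverseˡ (lift₀ reverse) ⟨
  lift₀ reverse ⟨$⟩ˡ (lift₀ reverse ⟨$⟩ʳ (π ⟨$⟩ʳ opposite i)) ≡⟨ cong (lift₀ reverse ⟨$⟩ˡ_) (T (opposite i)) ⟨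
  lift₀ reverse ⟨$⟩ˡ (σ ⟨$⟩ʳ opposite (opposite i))             ≡⟨ cong (λ j → lift₀ reverse ⟨$⟩ˡ (σ ⟨$⟩ʳ j)) (opp-opp i) ⟩
  lift₀ reverse ⟨$⟩ˡ (σ ⟨$⟩ʳ i)                                 ≡⟨ lift₀-reverse-inverse (σ ⟨$⟩ʳ i) ⟩
  lift₀ reverse ⟨$⟩ʳ (σ ⟨$⟩ʳ i)                                 ∎
  where
  open ≡-Reasoning
  lift₀-reverse-inverse : ∀ {k} (v : Fin (suc k)) → lift₀ reverse ⟨$⟩ˡ v ≡ lift₀ reverse ⟨$⟩ʳ v
  lift₀-reverse-inverse zero = refl
  lift₀-reverse-inverse (suc v) = refl

-- Transfer of the statistics under the turn.

module Turn {k} (π σ : 𝔖 (suc k)) (T : Turned π σ) where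
  private
    module P = Shift π
    module Q = Shift σ
    m = pone π

  pone-turned : opposite m ≡ pone σ
  pone-turned = Q.is-m _ (trans (T m) (cong (lift₀ reverse ⟨$⟩ʳ_) P.π-m))

  opp≢ : ∀ i → i ≢ m → opposite i ≢ pone σ
  opp≢ i a e = a (opp-injective (trans e (sym pone-turned)))

  -- π(i) and its partner value in σ add up to n + 2, and the shift lowers both by 1. This is what
  -- `Flip` requires in order to compare the two histories.
  τ-sum : ∀ i → i ≢ m → suc (toℕ (shift σ ⟨$⟩ʳ opposite i) + toℕ (shift π ⟨$⟩ʳ i)) ≡ k
  τ-sum i a = ℕ.suc-injective (trans (cong suc (sym (ℕ.+-suc _ _))) (trans
    (cong₂ _+_ (trans (Q.τ-¬m (opposite i) (opp≢ i a)) (cong toℕ (T i))) (P.τ-¬m i a))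
    (sum (π ⟨$⟩ʳ i) (λ e → a (P.is-m i e)))))
    where
    sum : ∀ v → v ≢ zero → toℕ (lift₀ (reverse {k}) ⟨$⟩ʳ v) + toℕ v ≡ suc k
    sum zero b = contradiction refl b
    sum (suc v) b = trans (cong (λ z → suc z + suc (toℕ v)) (Fin.opposite-prop v)) (cong suc (ℕ.m∸n+n≡m (Fin.toℕ<n v)))

  open Flip (Φ π) (Φ σ) (Φ-coded π) (Φ-coded σ) m P.τ-m
    (trans (cong (λ z → toℕ (shift σ ⟨$⟩ʳ z)) pone-turned) Q.τ-m) τ-sum
    using (NE⇒SdE; SdE⇒NE; NE⇒SdE′; labels-NE; labels-SdE; label-law)

  -- Away from pone the letter classes {S, dE} and {N, E} are the non-excedances and the excedances,
  -- and the flip exchanges these classes.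
  Nep⇒Ep : ∀ i → i ≢ m → π ⟨$⟩ʳ i ≤ i → opposite i < σ ⟨$⟩ʳ opposite i
  Nep⇒Ep i a l with NE-pos σ (opposite i) (SdE⇒NE i a (Nep-SdE π i a l))
  ... | inj₁ e = contradiction e (opp≢ i a)
  ... | inj₂ q = q

  Ep⇒Nep : ∀ i → i ≢ m → opposite i < σ ⟨$⟩ʳ opposite i → π ⟨$⟩ʳ i ≤ i
  Ep⇒Nep i a l = SdE-Nep π i (NE⇒SdE i a (pos-NE σ (opposite i) (inj₂ l)))

  before⇒after : ∀ {i} → i < m → pone σ < opposite i
  before⇒after {i} l = subst (_< opposite i) pone-turned (opp-< {i = i} {m} l)

  after⇒before : ∀ {i} → m < i → opposite i < pone σ
  after⇒before {i} l = subst (opposite i <_) pone-turned (opp-< {i = m} {i} l)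

  before⇒after⁻ : ∀ {i} → pone σ < opposite i → i < m
  before⇒after⁻ {i} l = subst₂ _<_ (opp-opp i) (opp-opp m) (opp-< {i = opposite m} {opposite i} (subst (_< opposite i) (sym pone-turned) l))

  after⇒before⁻ : ∀ {i} → opposite i < pone σ → m < i
  after⇒before⁻ {i} l = subst₂ _<_ (opp-opp m) (opp-opp i) (opp-< {i = opposite i} {opposite m} (subst (opposite i <_) (sym pone-turned) l))

  Vnepb-turned : Vnepb π ≐ κ (suc (suc k)) (Vepa σ)
  Vnepb-turned i = χ-cong (Nep? π i ×-dec (i <? m)) (Ep? σ (opposite i) ×-dec (pone σ <? opposite i))
    (λ (l , b) → Nep⇒Ep i (λ { refl → ℕ.<-irrefl refl b }) l , before⇒after {i} b)
    (λ (l , b) → Ep⇒Nep i (λ { refl → ℕ.<-irrefl (cong toℕ (sym pone-turned)) b }) l , before⇒after⁻ {i} b)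

  Vnepa-turned : Vnepa π ≐ κ (suc (suc k)) (Vepb σ)
  Vnepa-turned i = χ-cong (Nep? π i ×-dec (m <? i)) (Ep? σ (opposite i) ×-dec (opposite i <? pone σ))
    (λ (l , b) → Nep⇒Ep i (λ { refl → ℕ.<-irrefl refl b }) l , after⇒before {i} b)
    (λ (l , b) → Ep⇒Nep i (λ { refl → ℕ.<-irrefl (cong toℕ pone-turned) b }) l , after⇒before⁻ {i} b)

  -- The label laws of `Flip` carry a correction y, which is 1 when pone is at or before i. `Vnepb`
  -- and `Vepa` express this correction in terms of π.
  Vnest-turned : Vnest π ⊔ Vnepb π ∖ Vepa π ≐ κ (suc (suc k)) (Vnest σ)
  Vnest-turned i = go (i Fin.≟ m) (NE? (Φ-step π i))
    where
    j = opposite i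
    y = χ (m ≤? i)
    label-NE≡ : ∀ (μ : 𝔖 (suc k)) i → NE (Φ-step μ i) → Φ-label μ i ≡ vnest μ i
    label-NE≡ μ i x = trans (cong (vnest μ i +_) (χ-no (SdE? (Φ-step μ i)) (λ z → SdE⇒¬NE z x))) (ℕ.+-identityʳ _)
    label-SdE≡ : ∀ (μ : 𝔖 (suc k)) i → SdE (Φ-step μ i) → Φ-label μ i ≡ suc (vnest μ i)
    label-SdE≡ μ i x = trans (cong (vnest μ i +_) (χ-yes (SdE? (Φ-step μ i)) x)) (ℕ.+-comm (vnest μ i) 1)
    go : Dec (i ≡ m) → Dec (NE (Φ-step π i)) → vnest π i + Vnepb π i ∸ Vepa π i ≡ vnest σ j
    -- At pone both nesting numbers vanish, since the shifted permutation takes its largest value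
    -- there.
    go (yes refl) _ = begin
      vnest π m + Vnepb π m ∸ Vepa π m
        ≡⟨ cong₂ (λ x z → vnest π m + x ∸ z)
             (χ-no (Nep? π m ×-dec (m <? m)) (λ (_ , l) → ℕ.<-irrefl refl l))
             (χ-no (Ep? π m ×-dec (m <? m)) (λ (_ , l) → ℕ.<-irrefl refl l)) ⟩
      vnest π m + 0                    ≡⟨ ℕ.+-identityʳ _ ⟩
      vnest π m                        ≡⟨ vnest-pone π ⟩
      0                                ≡⟨ vnest-pone σ ⟨
      vnest σ (pone σ)                 ≡⟨ cong (vnest σ) pone-turned ⟨
      vnest σ (opposite m)             ∎
      where
      open ≡-Reasoning
      vnest-pone : ∀ (μ : 𝔖 (suc k)) → vnest μ (pone μ) ≡ 0
      vnest-pone μ = trans (Labels.hi-m μ) (#-none (X? (shift μ) (pone μ)) (λ j (_ , l) → Labels.τ≤k μ j l))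
    -- At an excedance `Vepa` is y itself. The label gains 1 on the side of σ, where the letter is S
    -- or dE.
    go (no a) (yes x) = begin
      vnest π i + Vnepb π i ∸ Vepa π i ≡⟨ cong₂ (λ x z → vnest π i + x ∸ z) Vnepb≡0 Vepa≡y ⟩
      vnest π i + 0 ∸ y                ≡⟨ cong (_∸ y) (ℕ.+-identityʳ _) ⟩
      vnest π i ∸ y                    ≡⟨ cong (_∸ y) (ℕ.suc-injective key) ⟨
      vnest σ j + y ∸ y                ≡⟨ ℕ.m+n∸n≡m (vnest σ j) y ⟩
      vnest σ j                        ∎
      where
      open ≡-Reasoning
      ep : i < π ⟨$⟩ʳ i
      ep with NE-pos π i x
      ... | inj₁ e = contradiction e a
      ... | inj₂ l = l
      Vnepb≡0 : Vnepb π i ≡ 0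
      Vnepb≡0 = χ-no (Nep? π i ×-dec (i <? m)) (λ (l , _) → ℕ.<⇒≱ ep l)
      Vepa≡y : Vepa π i ≡ y
      Vepa≡y = χ-cong (Ep? π i ×-dec (m <? i)) (m ≤? i) (ℕ.<⇒≤ ∘ proj₂)
        (λ l → ep , ℕ.≤∧≢⇒< l (λ e → a (sym (Fin.toℕ-injective e))))
      key : suc (vnest σ j + y) ≡ suc (vnest π i)
      key = trans (cong (_+ y) (sym (label-SdE≡ σ j (NE⇒SdE′ i a x))))
        (trans (labels-NE i a x) (cong suc (label-NE≡ π i x)))
    -- Here `Vnepb` is the complement 1 - y.
    go (no a) (no ¬x) = begin
      vnest π i + Vnepb π i ∸ Vepa π i ≡⟨ cong (vnest π i + Vnepb π i ∸_) Vepa≡0 ⟩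
      vnest π i + Vnepb π i            ≡⟨ ℕ.+-cancelʳ-≡ y _ _ (trans (ℕ.+-assoc (vnest π i) _ _) key) ⟩
      vnest σ j                        ∎
      where
      open ≡-Reasoning
      x = ¬NE⇒SdE ¬x
      nep = SdE-Nep π i x
      Vepa≡0 : Vepa π i ≡ 0
      Vepa≡0 = χ-no (Ep? π i ×-dec (m <? i)) (λ (l , _) → ℕ.<⇒≱ l nep)
      Vnepb+y : Vnepb π i + y ≡ 1
      Vnepb+y = sym (χ-⊎ (yes tt) (Nep? π i ×-dec (i <? m)) (m ≤? i) (λ _ → f (i <? m)) _ _ (λ (_ , l) → ℕ.<⇒≱ l))
        where
        f : Dec (i < m) → (π ⟨$⟩ʳ i ≤ i × i < m) ⊎ m ≤ i
        f (yes l) = inj₁ (nep , l)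
        f (no l) = inj₂ (ℕ.≮⇒≥ l)
      key : vnest π i + (Vnepb π i + y) ≡ vnest σ j + y
      key = begin
        vnest π i + (Vnepb π i + y) ≡⟨ cong (vnest π i +_) Vnepb+y ⟩
        vnest π i + 1               ≡⟨ ℕ.+-comm (vnest π i) 1 ⟩
        suc (vnest π i)             ≡⟨ label-SdE≡ π i x ⟨
        Φ-label π i                 ≡⟨ labels-SdE i x ⟨
        Φ-label σ j + y             ≡⟨ cong (_+ y) (label-NE≡ σ j (SdE⇒NE i a x)) ⟩
        vnest σ j + y               ∎

  -- `label-law` says b + e = g + c, so height minus label is preserved. Adding b to both terms of e
  -- ∸ c and c to both terms of g ∸ b gives the same truncated difference.
  Vedif-turned : Vedif π ∖ Vnepb π ∖ Vnepa π ∖ Vnest π ≐ κ (suc (suc k)) (Vedif σ ∖ Vnepb σ ∖ Vnepa σ ∖ Vnest σ)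
  Vedif-turned i = begin
    (Vedif π ∖ Vnepb π ∖ Vnepa π ∖ Vnest π) i ≡⟨ Vedif∖≡h∸label π i ⟩
    e ∸ c                                     ≡⟨ ℕ.[m+n]∸[m+o]≡n∸o b e c ⟨
    (b + e) ∸ (b + c)                         ≡⟨ cong₂ _∸_ (trans (label-law i) (ℕ.+-comm g c)) (ℕ.+-comm b c) ⟩
    (c + g) ∸ (c + b)                         ≡⟨ ℕ.[m+n]∸[m+o]≡n∸o c g b ⟩
    g ∸ b                                     ≡⟨ Vedif∖≡h∸label σ (opposite i) ⟨
    (Vedif σ ∖ Vnepb σ ∖ Vnepa σ ∖ Vnest σ) (opposite i) ∎
    where
    open ≡-Reasoning
    b = label (Φ σ) (opposite i)
    c = label (Φ π) i
    g = h (Φ σ) (opposite i)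
    e = h (Φ π) i

  -- A value is an excedance value when its preimage is smaller. The turn sends the value i + 1 to n
  -- - i + 1 and its preimage j to n + 1 - j, so j ≤ i holds exactly when the turned pair is not an
  -- excedance.
  Vnex-turned : interval k ∖ Vnex π ≐ κ (suc k) (Vnex σ)
  Vnex-turned i = χ-∸-¬ (Exc? π (suc i)) (¬? (Exc? σ (suc (opposite i)))) fwd bwd
    where
    j = π ⟨$⟩ˡ suc i
    preimage : σ ⟨$⟩ˡ suc (opposite i) ≡ opposite j
    preimage = trans (cong (σ ⟨$⟩ˡ_) (sym (trans (T j) (cong (lift₀ reverse ⟨$⟩ʳ_) (inverseʳ π))))) (inverseˡ σ)
    -- Links the reflections of [n] and of [n-1]: n + 1 - i = (n - i) + 1.
    opposite-inject₁ : toℕ (opposite (inject₁ i)) ≡ toℕ (suc (opposite i))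
    opposite-inject₁ = begin
      toℕ (opposite (inject₁ i))  ≡⟨ Fin.opposite-prop (inject₁ i) ⟩
      k ∸ toℕ (inject₁ i)         ≡⟨ cong (k ∸_) (Fin.toℕ-inject₁ i) ⟩
      k ∸ toℕ i                   ≡⟨ ℕ.+-∸-assoc 1 (Fin.toℕ<n i) ⟩
      suc (k ∸ suc (toℕ i))       ≡⟨ cong suc (Fin.opposite-prop i) ⟨
      suc (toℕ (opposite i))      ∎
      where open ≡-Reasoning
    fwd : Exc π (suc i) → ¬ Exc σ (suc (opposite i))
    fwd p q = ℕ.<⇒≱ (subst₂ ℕ._<_ (cong toℕ preimage) (sym opposite-inject₁) (Exc⇒ σ _ q))
      (opp-≤ (subst (toℕ j ℕ.≤_) (sym (Fin.toℕ-inject₁ i)) (ℕ.≤-pred (Exc⇒ π _ p))))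
    bwd : ¬ Exc σ (suc (opposite i)) → Exc π (suc i)
    bwd ¬q = ⇒Exc π _ (ℕ.≰⇒> (λ l → ¬q (⇒Exc σ _
      (subst₂ ℕ._<_ (cong toℕ (sym preimage)) opposite-inject₁ (opp-< (subst (ℕ._< toℕ j) (sym (Fin.toℕ-inject₁ i)) l))))))

-- Assembly of the identities.

κ-sym : ∀ {M} {A B : Multiset (ℕ.pred M)} → A ≐ κ M B → B ≐ κ M A
κ-sym {B = B} p i = trans (cong B (sym (opp-opp i))) (sym (p (opposite i)))

corollary4p18 :
    (k : ℕ) (ξ : 𝔏 (suc k) → 𝔏 (suc k)) → IsXi ξ → (π : 𝔖 (suc k)) →
    let n = suc k
        σ = ρ ξ π
    in
      (Vnepb π ≐ κ (suc n) (Vepa σ)) ×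
      (Vnepa π ≐ κ (suc n) (Vepb σ)) ×
      (Vepb π ≐ κ (suc n) (Vnepa σ)) ×
      (Vepa π ≐ κ (suc n) (Vnepb σ)) ×
      (Vnest π ⊔ Vnepb π ∖ Vepa π ≐ κ (suc n) (Vnest σ)) ×
      (Vnest π ≐ κ (suc n) (Vnest σ ⊔ Vnepb σ ∖ Vepa σ)) ×
      (Vedif π ∖ Vnepb π ∖ Vnepa π ∖ Vnest π
        ≐ κ (suc n) (Vedif σ ∖ Vnepb σ ∖ Vnepa σ ∖ Vnest σ)) ×
      (interval k ∖ Vnex π ≐ κ n (Vnex σ))
corollary4p18 k ξ X π =
    P.Vnepb-turned , P.Vnepa-turned
  -- These identities are earlier ones with π and σ exchanged, turned around because the reflection
  -- is an involution.
  , κ-sym {M} Q.Vnepa-turned , κ-sym {M} Q.Vnepb-turned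
  , P.Vnest-turned , κ-sym {M} Q.Vnest-turned
  , P.Vedif-turned , P.Vnex-turned
  where
  M = suc (suc k)
  σ = ρ ξ π
  T : Turned π σ
  T i = trans (ρ≈turn X π (opposite i)) (cong (λ z → lift₀ reverse ⟨$⟩ʳ (π ⟨$⟩ʳ z)) (opp-opp i))
  module P = Turn π σ T
  module Q = Turn σ π (Turned-sym {π = π} {σ} T)
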